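{- For every composition $\alpha$, the augmented quasicrystal skeleton $\mathsf{QCS}^+_\alpha$ is connected (as a graph, ignoring orientations of edges).
   Context: Diagrams are in French notation: rows are numbered from bottom to top, columns from left to right. The diagram of a composition $\alpha$ has $\alpha_r$ left-justified cells in row $r$. $\mathsf{SYT}(\lambda)$ is the set of standard Young tableaux of partition shape $\lambda$, $n=|\lambda|$. $[a,b]=\{a,\ldots,b\}$. $\mathsf{row}(T)$ is the row reading word: rows read from top to bottom, each from left to right. For a word $\pi$ and interval $J$, $\pi|_J$ is the subword of letters in $J$. Dyck pattern interval: with $\pi=\mathsf{row}(T)$, an interval $I=[i,i+2m]\subseteq[1,n]$, $m\geqslant1$, is a Dyck pattern interval of $T$ if the RSK insertion tableaux of $\pi|_I$ and $\pi|_{[i,i+m]}$ have shapes $(m+1,m)$ and $(m+1)$. Associate to each letter of $[i+m+1,i+2m]$ in $\pi|_I$ an open bracket and to each letter of $[i,i+m]$ a closed bracket; exactly one closed bracket is unpaired; let $k\in[i,i+m]$ be its letter. $I\cdot T$ is obtained from $T$ by replacing the entry $k$ by $k+m$ and each entry $x$ with $k<x\leqslant k+m$ by $x-1$. Crystal skeleton $\mathsf{CS}(\lambda)$: directed graph on $\mathsf{SYT}(\lambda)$ with an edge $T\to I\cdot T$ for every Dyck pattern interval $I$ of $T$. Standard Young composition tableau of shape $\alpha$ ($|\alpha|=n$): a bijective filling $\widehat T$ of the diagram of $\alpha$ with $1,\ldots,n$ such that (1) rows increase from left to right; (2) the leftmost column increases from bottom to top; (3) if $r'>r$, $(r,c+1)$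 is in the diagram, and $\widehat T(r,c+1)\geqslant \widehat T(r',c)$, then $\widehat T(r,c+1)>\widehat T(r',c+1)$, where empty cells are considered to contain $\infty$. The map $\varphi$ from standard Young composition tableaux of shapes rearranging $\lambda$ to $\mathsf{SYT}(\lambda)$, which sorts each column in increasing order from bottom to top, is a bijection. Its inverse $\varphi^{ -1}$: write the leftmost column of $T$ increasing bottom to top; then, column by column from left to right, place the entries of each column of $T$ from smallest to largest, each into the highest unoccupied cell of that column whose left neighbor is smaller. Quasicrystal skeleton $\mathsf{QCS}_\alpha$: for $\alpha$ a rearrangement of the partition $\lambda$, the induced subgraph of $\mathsf{CS}(\lambda)$ on all $T$ such that $\varphi^{ -1}(T)$ has shape $\alpha$. Its vertices may equivalently be labeled by the standard Young composition tableaux $\widehat T=\varphi^{ -1}(T)$ of shape $\alpha$. Operators $t_i$: if $i$ and $i+1$ are entries of a standard Young composition tableau $\widehat T$ whose columns differ by more than $1$ in absolute value, and $i+1$ is in a higher row than $i$, then $t_i(\widehat T)$ is the standard Young composition tableau obtained by swapping the entries $i$ and $i+1$. Augmented quasicrystal skeleton $\mathsf{QCS}^+_\alpha$: the graph $\mathsf{QCS}_\alpha$ together with all edges $\widehat T\stackrel{t_i}{\longrightarrow}t_i(\widehat T)$ for $\widehat T\in\mathsf{QCS}_\alpha$ (whenever $t_i(\widehat T)$ is defined). -}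

module Defs where

open import Data.Bool.Base using (true; false; if_then_else_; _∧_)
open import Data.List.Base
  using (List; []; _∷_; [_]; map; concat; reverse; foldl; foldr; filter; mapMaybe; upTo; length)
open import Data.List.Relation.Binary.Permutation.Propositional using (_↭_)
open import Data.List.Relation.Unary.All using (All)
open import Data.List.Relation.Unary.Linked using (Linked)
open import Data.List.Sort.InsertionSort.Base using (sort)
open import Data.Maybe.Base using (Maybe; just; nothing)
open import Data.Nat.Base
  using (ℕ; zero; suc; _+_; _*_; _∸_; _≤_; _<_; _⊔_; ∣_-_∣)
open import Data.Nat.ListAction using (sum)
open import Data.Nat.Properties using (≤-decTotalOrder; _≤?_; _<?_; _≟_)
open import Data.Product.Base using (∃-syntax; _×_; _,_; map₁)
open import Data.Sum.Base using (_⊎_)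
open import Relation.Binary.Construct.Add.Supremum.NonStrict _≤_ using (_≤⁺_)
open import Relation.Binary.Construct.Add.Supremum.Strict _<_ using (_<⁺_)
open import Relation.Binary.Construct.Closure.Equivalence using (EqClosure)
open import Relation.Binary.PropositionalEquality.Core using (_≡_)
open import Relation.Nullary.Construct.Add.Supremum using (_⁺)
open import Relation.Nullary.Decidable using (⌊_⌋; _×-dec_)

-- Directed graphs whose vertices are the elements of A satisfying Vertex;
-- Edge is only meaningful between vertices.
record Graph (A : Set) : Set₁ where
  field
    Vertex : A → Set
    Edge   : A → A → Set

  Adjacent : A → A → Set
  Adjacent x y = Vertex x × Vertex y × Edge x y

open Graph public

-- Connected as an undirected graph; the graph with no vertices does not count
-- as connected.
Connected : {A : Set} → Graph A → Set
Connected G =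
  (∃[ x ] Vertex G x) ×
  (∀ x y → Vertex G x → Vertex G y → EqClosure (Adjacent G) x y)

inducedSubgraph : {A : Set} → Graph A → (A → Set) → Graph A
inducedSubgraph G P = record
  { Vertex = λ x → Vertex G x × P x
  ; Edge   = Edge G
  }

IsComposition : List ℕ → Set
IsComposition α = All (1 ≤_) α

-- The partition of which α is a rearrangement: the parts in decreasing order.
partitionOf : List ℕ → List ℕ
partitionOf α = reverse (sort ≤-decTotalOrder α)

-- A filling is the list of its rows from bottom to top, each row being listed
-- from left to right.
Tableau : Set
Tableau = List (List ℕ)

shape : Tableau → List ℕ
shape = map length

size : Tableau → ℕ
size T = sum (shape T)

_!?_ : {A : Set} → List A → ℕ → Maybe A
[]       !? _     = nothing
(x ∷ xs) !? zero  = just x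
(x ∷ xs) !? suc i = xs !? i

-- The entry in row r and column c, both counted from 0; an empty cell (in
-- particular any cell outside the shape) holds the added supremum.
entry : Tableau → ℕ → ℕ → ℕ ⁺
entry []       _       _ = nothing
entry (R ∷ _)  zero    c = R !? c
entry (_ ∷ Rs) (suc r) c = entry Rs r c

-- Rows too short to meet column c are skipped.
column : ℕ → Tableau → List ℕ
column c = mapMaybe (_!? c)

-- The columns from left to right, each listed from bottom to top.
columns : Tableau → List (List ℕ)
columns T = map (λ c → column c T) (upTo (foldr _⊔_ 0 (shape T)))

record IsStandardFilling (α : List ℕ) (T : Tableau) : Set where
  field
    hasShape  : shape T ≡ α
    bijective : concat T ↭ map suc (upTo (sum α))

record IsSYT (lam : List ℕ) (T : Tableau) : Set where
  field
    standard          : IsStandardFilling lam T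
    rowsIncreasing    : All (Linked _<_) T
    columnsIncreasing : All (Linked _<_) (columns T)

record IsSYCT (α : List ℕ) (T : Tableau) : Set where
  field
    standard           : IsStandardFilling α T
    rowsIncreasing     : All (Linked _<_) T
    leftmostIncreasing : Linked _<_ (column 0 T)
    triple             : ∀ r r′ c x → r < r′ → entry T r (suc c) ≡ just x →
                         entry T r′ c ≤⁺ just x → entry T r′ (suc c) <⁺ just x

row : Tableau → List ℕ
row T = concat (reverse T)

infix 8 _∣[_,_]
_∣[_,_] : List ℕ → ℕ → ℕ → List ℕ
w ∣[ a , b ] = filter (λ x → (a ≤? x) ×-dec (x ≤? b)) w

-- Row insertion of x into a single row: the new row and the bumped letter.
insertRow : ℕ → List ℕ → List ℕ × Maybe ℕ
insertRow x []       = [ x ] , nothing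
insertRow x (y ∷ ys) =
  if ⌊ x <? y ⌋ then (x ∷ ys , just y) else map₁ (y ∷_) (insertRow x ys)

insert : Tableau → ℕ → Tableau
insert []       x = [ [ x ] ]
insert (R ∷ Rs) x with insertRow x R
... | R′ , nothing = R′ ∷ Rs
... | R′ , just y  = R′ ∷ insert Rs y

insertionTableau : List ℕ → Tableau
insertionTableau = foldl insert []

-- The interval [ i , i + 2m ] is a Dyck pattern interval of T.
record IsDyckPatternInterval (T : Tableau) (i m : ℕ) : Set where
  field
    m≥1         : 1 ≤ m
    lower       : 1 ≤ i
    upper       : i + 2 * m ≤ size T
    shape-whole : shape (insertionTableau (row T ∣[ i , i + 2 * m ])) ≡ suc m ∷ m ∷ []
    shape-half  : shape (insertionTableau (row T ∣[ i , i + m ])) ≡ suc m ∷ []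

-- Letters > b are open brackets and letters ≤ b are closed brackets; the result
-- lists the unpaired closed brackets of the word, where the first argument is
-- the number of open brackets still waiting to be paired.
unpairedClosed : ℕ → (b : ℕ) → List ℕ → List ℕ
unpairedClosed d b []       = []
unpairedClosed d b (x ∷ xs) with ⌊ b <? x ⌋ | d
... | true  | _      = unpairedClosed (suc d) b xs
... | false | zero   = x ∷ unpairedClosed zero b xs
... | false | suc d′ = unpairedClosed d′ b xs

cycleLetter : (k m x : ℕ) → ℕ
cycleLetter k m x =
  if ⌊ x ≟ k ⌋ then k + m
  else if ⌊ k <? x ⌋ ∧ ⌊ x ≤? k + m ⌋ then x ∸ 1
  else x

-- U = I · T for a Dyck pattern interval I = [ i , i + 2m ] of T, with k the
-- letter of the unique unpaired closed bracket.
CSEdge : Tableau → Tableau → Set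
CSEdge T U =
  ∃[ i ] ∃[ m ] ∃[ k ]
    IsDyckPatternInterval T i m ×
    unpairedClosed 0 (i + m) (row T ∣[ i , i + 2 * m ]) ≡ [ k ] ×
    U ≡ map (map (cycleLetter k m)) T

CS : List ℕ → Graph Tableau
CS lam = record { Vertex = IsSYT lam ; Edge = CSEdge }

-- Sort every column. The sorted columns have weakly decreasing lengths and are
-- bottom-justified, so reading off the "columns" of the list of columns
-- recovers the rows.
φ : Tableau → Tableau
φ T = columns (map (sort ≤-decTotalOrder) (columns T))

-- T̂ is a composition tableau of shape α and T̂ = φ⁻¹(T).
IsLabel : List ℕ → Tableau → Tableau → Set
IsLabel α T T̂ = IsSYCT α T̂ × φ T̂ ≡ T

φ⁻¹HasShape : List ℕ → Tableau → Set
φ⁻¹HasShape α T = ∃[ T̂ ] IsLabel α T T̂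

QCS : List ℕ → Graph Tableau
QCS α = inducedSubgraph (CS (partitionOf α)) (φ⁻¹HasShape α)

swapLetters : (i j x : ℕ) → ℕ
swapLetters i j x = if ⌊ x ≟ i ⌋ then j else if ⌊ x ≟ j ⌋ then i else x

-- t i is defined at T̂, with value Û.
record t (i : ℕ) (T̂ Û : Tableau) : Set where
  field
    r r′ c c′   : ℕ
    position-i  : entry T̂ r c ≡ just i
    position-i+ : entry T̂ r′ c′ ≡ just (suc i)
    columnsFar  : 1 < ∣ c - c′ ∣
    higher      : r < r′
    value       : Û ≡ map (map (swapLetters i (suc i))) T̂

QCS⁺ : List ℕ → Graph Tableau
QCS⁺ α = record
  { Vertex = Vertex (QCS α)
  ; Edge   = λ T U → Edge (QCS α) T U ⊎
               (∃[ i ] ∃[ T̂ ] ∃[ Û ] IsLabel α T T̂ × IsLabel α U Û × t i T̂ Û)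
  }

{-# OPTIONS --safe #-}

-- A composition tableau of shape α with n cells is a way of growing α cell by
-- cell, and φ adds the successive cells of the growth to the sorted tableau in
-- rows that depend only on the shapes met. By induction on n, it suffices to
-- move the letter n to the end of the top row, which is always removable. Let
-- n end a lower row in column c, and let the top row end in column d. If
-- |c - d| > 1, then by induction n - 1 ends the top row, and some t i exchanges
-- the two. If d = c or d = c + 1, then by induction n - 1 and n - 2 are both at
-- the end of the top row, and the words c-1 c c and c c+1 c of the columns of
-- n-2, n-1, n can be changed by a Knuth relation, that is, by a Dyck pattern
-- interval with m = 1, to words that place n in the top row. If d = c - 1, then
-- n could not have been added at the end of its row.
module Submission where

open import Defs
open import Data.List.Base
  using (List; []; _∷_; [_]; _++_; map; concat; reverse; foldr; length; applyUpTo; upTo; filter; initLast; _∷ʳ′_)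
open import Data.List.Membership.Propositional using (_∈_)
open import Data.List.Membership.Propositional.Properties using (∈-++⁻)
open import Data.List.Properties
  using ( map-upTo; map-applyUpTo; upTo-∷ʳ; map-++; map-∘; map-cong; length-++; length-map; ++-assoc; ++-identityʳ
        ; reverse-applyUpTo; reverse-involutive; unfold-reverse; concat-++; filter-++; filter-none; filter-accept
        ; filter-reject; ∷-injectiveˡ; ∷-injectiveʳ)
open import Data.List.Relation.Binary.Permutation.Propositional
  using (_↭_; prep; ↭-refl; ↭-sym; ↭-trans; ↭-swap; ↭⇒↭ₛ; ↭-reflexive; module PermutationReasoning)
open import Data.List.Relation.Binary.Permutation.Propositional.Properties
  using (shift; ↭-reverse; All-resp-↭; ∈-resp-↭; ↭-length; ∷↭∷ʳ; drop-∷; ++⁺ˡ)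
open import Data.List.Relation.Binary.Pointwise using (Pointwise-≡⇒≡)
open import Data.List.Relation.Unary.All as All using (All; []; _∷_)
import Data.List.Relation.Unary.All.Properties as All
open import Data.List.Relation.Unary.AllPairs using (AllPairs; []; _∷_)
import Data.List.Relation.Unary.AllPairs.Properties as AllPairs
open import Data.List.Relation.Unary.Any using (here; there)
open import Data.List.Relation.Unary.Linked using (Linked; []; [-]; _∷_; tail)
import Data.List.Relation.Unary.Linked.Properties as Linked
import Data.List.Relation.Unary.Sorted.TotalOrder.Properties as Sorted
open import Data.List.Sort.InsertionSort.Base using (sort)
open import Data.List.Sort.InsertionSort.Properties using (sort-↭; sort-↗)
open import Data.Maybe.Base using (Maybe; just; nothing; maybe′)
open import Data.Maybe.Properties using (just-injective)
open import Data.Nat.Base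
open import Data.Nat.ListAction using (sum)
open import Data.Nat.ListAction.Properties using (sum-↭)
open import Data.Nat.Properties
open import Data.Product.Base using (∃-syntax; _×_; _,_; map₁; proj₂)
open import Data.Sum.Base using (_⊎_; inj₁; inj₂)
open import Function.Base using (_∘_; id)
open import Relation.Binary.Construct.Add.Supremum.NonStrict _≤_ as NonStrict using (_≤⁺_)
open import Relation.Binary.Construct.Add.Supremum.Strict _<_ as Strict using (_<⁺_)
open import Relation.Binary.Construct.Closure.Equivalence as EqClosure using (EqClosure; symmetric; return)
open import Relation.Binary.Construct.Closure.ReflexiveTransitive using (ε; _◅◅_)
import Relation.Binary.Construct.On as On
open import Relation.Binary.PropositionalEquality hiding ([_])
open import Relation.Nullary using (¬_; Dec; yes; no; contradiction)
open import Relation.Nullary.Decidable using (_×-dec_)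
open import Relation.Unary using (Decidable)

-- The two kinds of edges are read from different tableaux: crystal edges from `tableau p`, the
-- operators `t` from `label p`. A growth `p` builds both by appending letters, so neither φ nor its
-- inverse has to be evaluated along an edge: an edge stays inside the given shape as soon as
-- growths of that shape are exhibited for both of its ends. The row that receives a letter in
-- `tableau p` is the height of its column, so `tableau p` depends only on the sequence of columns,
-- and a crystal edge rewrites that sequence. Appending the same cell to both ends of an edge gives
-- an edge again; this is what makes the induction on the number of cells work.
--
-- When n - 1 and n lie in equal or adjacent columns, no operator exchanges them, and a Knuth
-- relation needs a third letter as witness; hence n - 2 is placed in the top row as well. It then
-- remains to see that the rewritten growth is legal: the top row must not have length c at the
-- moment when a lower cell is added in column c.

private variable
  r s c d i j k m n x y z b p q r₁ r₂ r₃ s₁ s₂ s₃ : ℕ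
  α β β₁ β₂ γ δ₁ δ₂ zs zs′ xs ys : List ℕ
  T U : Tableau

-- Corners, column heights and transposition

snocAt : ℕ → ℕ → Tableau → Tableau
snocAt r       x []       = [ [ x ] ]
snocAt zero    x (R ∷ Rs) = (R ++ [ x ]) ∷ Rs
snocAt (suc r) x (R ∷ Rs) = R ∷ snocAt r x Rs

data At : ℕ → ℕ → List ℕ → Set where
  end   : At 0 0 []
  here  : At 0 c (c ∷ β)
  there : At r c β → At (suc r) c (b ∷ β)

data Corner : ℕ → ℕ → List ℕ → Set where
  end   : Corner 0 0 []
  here  : All (_≤ c) β → Corner 0 c (c ∷ β)
  there : c < b → Corner r c β → Corner (suc r) c (b ∷ β)

Corner⇒At : Corner r c β → At r c β
Corner⇒At end         = end
Corner⇒At (here _)    = here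
Corner⇒At (there _ k) = there (Corner⇒At k)

At⇒≤length : At r c β → r ≤ length β
At⇒≤length end       = z≤n
At⇒≤length here      = z≤n
At⇒≤length (there a) = s≤s (At⇒≤length a)

indicator : ℕ → ℕ → ℕ
indicator c       zero    = 0
indicator zero    (suc b) = 1
indicator (suc c) (suc b) = indicator c b

-- The length of column `c`, that is, part `c` of the conjugate shape.
height : ℕ → List ℕ → ℕ
height c []      = 0
height c (b ∷ β) = indicator c b + height c β

indicator-< : c < b → indicator c b ≡ 1
indicator-< {zero}  (s≤s _)   = refl
indicator-< {suc c} (s≤s c<b) = indicator-< c<b

indicator-≥ : b ≤ c → indicator c b ≡ 0
indicator-≥ z≤n       = refl
indicator-≥ (s≤s b≤c) = indicator-≥ b≤c

indicator-≤1 : ∀ c b → indicator c b ≤ 1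
indicator-≤1 c       zero    = z≤n
indicator-≤1 zero    (suc b) = ≤-refl
indicator-≤1 (suc c) (suc b) = indicator-≤1 c b

indicator-antitone : ∀ b → j ≤ c → indicator c b ≤ indicator j b
indicator-antitone zero    _         = z≤n
indicator-antitone {c = c} (suc b) z≤n = indicator-≤1 c (suc b)
indicator-antitone (suc b) (s≤s j≤c) = indicator-antitone b j≤c

indicator-suc : j ≢ c → indicator j (suc c) ≡ indicator j c
indicator-suc {zero}  {zero}  j≢c = contradiction refl j≢c
indicator-suc {zero}  {suc c} j≢c = refl
indicator-suc {suc j} {zero}  j≢c = refl
indicator-suc {suc j} {suc c} j≢c = indicator-suc (j≢c ∘ cong suc)

height-antitone : ∀ β → j ≤ c → height c β ≤ height j β
height-antitone []      j≤c = z≤n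
height-antitone (b ∷ β) j≤c = +-mono-≤ (indicator-antitone b j≤c) (height-antitone β j≤c)

height-zero : All (_≤ c) β → height c β ≡ 0
height-zero []         = refl
height-zero (b≤c ∷ bs) = cong₂ _+_ (indicator-≥ b≤c) (height-zero bs)

-- The row of length `c` meets column `j` but not column `c`.
height-strict : At r c β → j < c → height c β < height j β
height-strict {c = c} {j = j} (here {β = β}) j<c
  rewrite indicator-≥ (≤-refl {c}) | indicator-< j<c = s≤s (height-antitone β (<⇒≤ j<c))
height-strict {c = c} {j = j} (there {β = β} {b = b} a) j<c =
  +-mono-≤-< (indicator-antitone b (<⇒≤ j<c)) (height-strict a j<c)

Corner⇒height : Corner r c β → height c β ≡ r
Corner⇒height end = refl
Corner⇒height {c = c} (here bs) = cong₂ _+_ (indicator-≥ (≤-refl {c})) (height-zero bs)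
Corner⇒height (there c<b k) = cong₂ _+_ (indicator-< c<b) (Corner⇒height k)

!?-snoc-≡ : ∀ (R : List ℕ) x → (R ++ [ x ]) !? length R ≡ just x
!?-snoc-≡ []      x = refl
!?-snoc-≡ (_ ∷ R) x = !?-snoc-≡ R x

!?-snoc-≢ : ∀ (R : List ℕ) x → j ≢ length R → (R ++ [ x ]) !? j ≡ R !? j
!?-snoc-≢ {zero}  []      x j≢ = contradiction refl j≢
!?-snoc-≢ {suc j} []      x j≢ = refl
!?-snoc-≢ {zero}  (_ ∷ R) x j≢ = refl
!?-snoc-≢ {suc j} (_ ∷ R) x j≢ = !?-snoc-≢ R x (j≢ ∘ cong suc)

!?-≥ : ∀ (R : List ℕ) → length R ≤ j → R !? j ≡ nothing
!?-≥ []      _         = refl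
!?-≥ (_ ∷ R) (s≤s R≤j) = !?-≥ R R≤j

column-≢ : ∀ S x → At r c (shape S) → j ≢ c → column j (snocAt r x S) ≡ column j S
column-≢ {j = zero}  []       x end j≢c = contradiction refl j≢c
column-≢ {j = suc j} []       x end j≢c = refl
column-≢ (R ∷ Rs) x here      j≢c rewrite !?-snoc-≢ R x j≢c = refl
column-≢ {j = j} (R ∷ Rs) x (there a) j≢c with R !? j
... | nothing = column-≢ Rs x a j≢c
... | just y  = cong (y ∷_) (column-≢ Rs x a j≢c)

column-↭ : ∀ S x → At r c (shape S) → column c (snocAt r x S) ↭ x ∷ column c S
column-↭ []       x end = ↭-refl
column-↭ (R ∷ Rs) x here rewrite !?-snoc-≡ R x | !?-≥ R ≤-refl = ↭-refl
column-↭ {c = c} (R ∷ Rs) x (there a) with R !? c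
... | nothing = column-↭ Rs x a
... | just y  = ↭-trans (prep y (column-↭ Rs x a)) (↭-swap y x ↭-refl)

length-column : ∀ j S → length (column j S) ≡ height j (shape S)
length-column j []       = refl
length-column j (R ∷ Rs) = helper R j (length-column j Rs)
  where
  helper : ∀ (R′ : List ℕ) j′ → length (column j Rs) ≡ height j (shape Rs) →
    length (maybe′ _∷_ id (R′ !? j′) (column j Rs)) ≡ indicator j′ (length R′) + height j (shape Rs)
  helper []       j′       eq = eq
  helper (y ∷ R′) zero     eq = cong suc eq
  helper (y ∷ R′) (suc j′) eq = helper R′ j′ eq

column-zero : ∀ S → All (_≤ j) (shape S) → column j S ≡ []
column-zero []       []         = refl
column-zero (R ∷ Rs) (R≤j ∷ bs) rewrite !?-≥ R R≤j = column-zero Rs bs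

column-corner : ∀ S x → Corner r c (shape S) → column c (snocAt r x S) ≡ column c S ++ [ x ]
column-corner []       x end = refl
column-corner (R ∷ Rs) x (here bs) rewrite !?-snoc-≡ R x | !?-≥ R ≤-refl | column-zero Rs bs = refl
column-corner {c = c} (R ∷ Rs) x (there _ k) with R !? c
... | nothing = column-corner Rs x k
... | just y  = cong (y ∷_) (column-corner Rs x k)

width : Tableau → ℕ
width S = foldr _⊔_ 0 (shape S)

columns-applyUpTo : ∀ S → columns S ≡ applyUpTo (λ j → column j S) (width S)
columns-applyUpTo S = map-upTo (λ j → column j S) (width S)

shape-columns : ∀ S → shape (columns S) ≡ applyUpTo (λ j → height j (shape S)) (width S)
shape-columns S = begin
  shape (columns S)                                     ≡⟨ map-∘ (upTo (width S)) ⟨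
  map (λ j → length (column j S)) (upTo (width S))      ≡⟨ map-cong (λ j → length-column j S) (upTo (width S)) ⟩
  map (λ j → height j (shape S)) (upTo (width S))       ≡⟨ map-upTo _ (width S) ⟩
  applyUpTo (λ j → height j (shape S)) (width S)        ∎
  where open ≡-Reasoning

≤-foldr⊔ : ∀ β → All (_≤ foldr _⊔_ 0 β) β
≤-foldr⊔ []      = []
≤-foldr⊔ (b ∷ β) = m≤m⊔n b _ ∷ All.map (λ y≤ → ≤-trans y≤ (m≤n⊔m b _)) (≤-foldr⊔ β)

column-≥width : ∀ S → width S ≤ j → column j S ≡ []
column-≥width S w≤j = column-zero S (All.map (λ y≤ → ≤-trans y≤ w≤j) (≤-foldr⊔ (shape S)))

At⇒≤width : At r c β → c ≤ foldr _⊔_ 0 β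
At⇒≤width end               = z≤n
At⇒≤width here              = m≤m⊔n _ _
At⇒≤width (there {b = b} a) = ≤-trans (At⇒≤width a) (m≤n⊔m b _)

width-snocAt : ∀ S x → At r c (shape S) → width (snocAt r x S) ≡ suc c ⊔ width S
width-snocAt []       x end = refl
width-snocAt (R ∷ Rs) x here rewrite length-++ R {[ x ]} | +-comm (length R) 1 = begin
  suc (length R) ⊔ w                     ≡⟨ cong (_⊔ w) (m≥n⇒m⊔n≡m (n≤1+n (length R))) ⟨
  (suc (length R) ⊔ length R) ⊔ w        ≡⟨ ⊔-assoc (suc (length R)) (length R) w ⟩
  suc (length R) ⊔ (length R ⊔ w)        ∎
  where open ≡-Reasoning ; w = foldr _⊔_ 0 (shape Rs)
width-snocAt {c = c} (R ∷ Rs) x (there a) rewrite width-snocAt Rs x a = begin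
  length R ⊔ (suc c ⊔ w)  ≡⟨ ⊔-assoc (length R) (suc c) w ⟨
  (length R ⊔ suc c) ⊔ w  ≡⟨ cong (_⊔ w) (⊔-comm (length R) (suc c)) ⟩
  (suc c ⊔ length R) ⊔ w  ≡⟨ ⊔-assoc (suc c) (length R) w ⟩
  suc c ⊔ (length R ⊔ w)  ∎
  where open ≡-Reasoning ; w = foldr _⊔_ 0 (shape Rs)

applyUpTo-cong : ∀ {A : Set} {f g : ℕ → A} m → (∀ j → f j ≡ g j) → applyUpTo f m ≡ applyUpTo g m
applyUpTo-cong zero    eq = refl
applyUpTo-cong (suc m) eq = cong₂ _∷_ (eq 0) (applyUpTo-cong m (λ j → eq (suc j)))

-- If `c` equals `m`, then `snocAt` opens a new last entry `[ x ]`; the last premise makes `f⁺ c`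
-- agree with it.
applyUpTo-snocAt : ∀ {f f⁺ : ℕ → List ℕ} {x} c m → c ≤ m → (∀ {j} → j ≢ c → f⁺ j ≡ f j) →
  f⁺ c ≡ f c ++ [ x ] → (m ≤ c → f c ≡ []) → applyUpTo f⁺ (suc c ⊔ m) ≡ snocAt c x (applyUpTo f m)
applyUpTo-snocAt zero zero _ _ eq fc rewrite eq | fc z≤n = refl
applyUpTo-snocAt zero (suc m) _ neq eq _ = cong₂ _∷_ eq (applyUpTo-cong m (λ j → neq λ ()))
applyUpTo-snocAt (suc c) (suc m) (s≤s c≤m) neq eq fc =
  cong₂ _∷_ (neq λ ()) (applyUpTo-snocAt c m c≤m (λ j≢c → neq (j≢c ∘ suc-injective)) eq (fc ∘ s≤s))

applyUpTo-Corner : ∀ {g : ℕ → ℕ} c m → c ≤ m → (∀ {j} → j < c → r < g j) → g c ≡ r →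
  (∀ {j} → c ≤ j → g j ≤ r) → (m ≤ c → r ≡ 0) → Corner c r (applyUpTo g m)
applyUpTo-Corner zero zero _ _ eq _ r0 rewrite r0 z≤n = end
applyUpTo-Corner {r} {g} zero (suc m) _ _ eq ≤r _ =
  subst (λ b → Corner 0 r (b ∷ applyUpTo (g ∘ suc) m)) (sym eq) (here (All.applyUpTo⁺₂ (g ∘ suc) m (λ j → ≤r z≤n)))
applyUpTo-Corner (suc c) (suc m) (s≤s c≤m) r< eq ≤r r0 =
  there (r< z<s) (applyUpTo-Corner c m c≤m (r< ∘ s<s) eq (≤r ∘ s≤s) (r0 ∘ s≤s))

-- Column lengths weakly decrease, and by `height-strict` all columns before `c` are strictly longer
-- than column `c`; so the end of any row becomes a corner after transposition.
columns-Corner : ∀ S → At r c (shape S) → Corner c (height c (shape S)) (shape (columns S))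
columns-Corner {c = c} S a rewrite shape-columns S =
  applyUpTo-Corner c (width S) (At⇒≤width a) (height-strict a) refl (height-antitone (shape S))
    (λ w≤c → height-zero (All.map (λ y≤ → ≤-trans y≤ w≤c) (≤-foldr⊔ (shape S))))

-- Every row over a corner misses its column, so the new letter is the last one of that column.
columns-snocAt : ∀ S x → Corner r c (shape S) → columns (snocAt r x S) ≡ snocAt c x (columns S)
columns-snocAt {r} {c} S x k = begin
  columns (snocAt r x S)                        ≡⟨ columns-applyUpTo (snocAt r x S) ⟩
  applyUpTo _ (width (snocAt r x S))            ≡⟨ cong (applyUpTo _) (width-snocAt S x a) ⟩
  applyUpTo _ (suc c ⊔ width S)                 ≡⟨ applyUpTo-snocAt c (width S) (At⇒≤width a) (column-≢ S x a) (column-corner S x k) (column-≥width S) ⟩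
  snocAt c x (applyUpTo _ (width S))            ≡⟨ cong (snocAt c x) (columns-applyUpTo S) ⟨
  snocAt c x (columns S)                        ∎
  where open ≡-Reasoning ; a = Corner⇒At k

-- The map φ when a largest letter is added

Bounded : ℕ → Tableau → Set
Bounded n S = All (All (_≤ n)) S

column-All : ∀ {P : ℕ → Set} S → All (All P) S → All P (column j S)
column-All []       []       = []
column-All {j} {P} (R ∷ Rs) (pR ∷ pS) = helper R j pR
  where
  helper : ∀ R′ j′ → All P R′ → All P (maybe′ _∷_ id (R′ !? j′) (column j Rs))
  helper []       j′       _       = column-All Rs pS
  helper (y ∷ R′) zero     (p ∷ _) = p ∷ column-All Rs pS
  helper (y ∷ R′) (suc j′) (_ ∷ p) = helper R′ j′ p

columns-All : ∀ {P : ℕ → Set} S → All (All P) S → All (All P) (columns S)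
columns-All S p = All.map⁺ (All.universal (λ j → column-All S p) (upTo (width S)))

AllPairs-∷ʳ : ∀ {R : ℕ → ℕ → Set} → AllPairs R xs → All (λ y → R y x) xs → AllPairs R (xs ++ [ x ])
AllPairs-∷ʳ ps qs = AllPairs.++⁺ ps ([] ∷ []) (All.map (_∷ []) qs)

sort≡ : Linked _≤_ xs → xs ↭ ys → xs ≡ sort ≤-decTotalOrder ys
sort≡ {xs} {ys} s p = Pointwise-≡⇒≡ (Sorted.↗↭↗⇒≋ ≤-totalOrder s (sort-↗ ≤-decTotalOrder ys)
  (↭⇒↭ₛ (↭-trans p (↭-sym (sort-↭ ≤-decTotalOrder ys)))))

sort-∷ʳ : ys ↭ x ∷ xs → All (_≤ x) xs → sort ≤-decTotalOrder ys ≡ sort ≤-decTotalOrder xs ++ [ x ]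
sort-∷ʳ {ys} {x} {xs} p xs≤x = sym (sort≡
  (Linked.AllPairs⇒Linked (AllPairs-∷ʳ (Linked.Linked⇒AllPairs ≤-trans (sort-↗ ≤-decTotalOrder xs))
    (All-resp-↭ (↭-sym (sort-↭ ≤-decTotalOrder xs)) xs≤x)))
  (begin
    sort ≤-decTotalOrder xs ++ [ x ] ↭⟨ ∷↭∷ʳ x _ ⟨
    x ∷ sort ≤-decTotalOrder xs      ↭⟨ prep x (sort-↭ ≤-decTotalOrder xs) ⟩
    x ∷ xs                           ↭⟨ p ⟨
    ys                               ∎))
  where open PermutationReasoning

sortedColumns : Tableau → Tableau
sortedColumns S = map (sort ≤-decTotalOrder) (columns S)

sortedColumns-applyUpTo : ∀ S → sortedColumns S ≡ applyUpTo (λ j → sort ≤-decTotalOrder (column j S)) (width S)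
sortedColumns-applyUpTo S =
  trans (cong (map _) (columns-applyUpTo S)) (map-applyUpTo (λ j → column j S) _ (width S))

-- Sorting carries a largest letter to the end of its column from whichever row it entered.
sortedColumns-snocAt : ∀ S x → Bounded x S → At r c (shape S) →
  sortedColumns (snocAt r x S) ≡ snocAt c x (sortedColumns S)
sortedColumns-snocAt {r} {c} S x S≤x a = begin
  sortedColumns (snocAt r x S)         ≡⟨ sortedColumns-applyUpTo (snocAt r x S) ⟩
  applyUpTo _ (width (snocAt r x S))   ≡⟨ cong (applyUpTo _) (width-snocAt S x a) ⟩
  applyUpTo _ (suc c ⊔ width S)
    ≡⟨ applyUpTo-snocAt c (width S) (At⇒≤width a) (λ j≢c → cong (sort ≤-decTotalOrder) (column-≢ S x a j≢c))
        (sort-∷ʳ (column-↭ S x a) (column-All S S≤x)) (λ w≤c → cong (sort ≤-decTotalOrder) (column-≥width S w≤c)) ⟩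
  snocAt c x (applyUpTo _ (width S))   ≡⟨ cong (snocAt c x) (sortedColumns-applyUpTo S) ⟨
  snocAt c x (sortedColumns S)         ∎
  where open ≡-Reasoning

shape-sortedColumns : ∀ S → shape (sortedColumns S) ≡ shape (columns S)
shape-sortedColumns S = trans (sym (map-∘ (columns S)))
  (map-cong (λ C → ↭-length (sort-↭ ≤-decTotalOrder C)) (columns S))

sortedColumns-Corner : ∀ S → At r c (shape S) → Corner c (height c (shape S)) (shape (sortedColumns S))
sortedColumns-Corner S a rewrite shape-sortedColumns S = columns-Corner S a

-- Two transpositions: the corner of the sorted columns is in particular an end of a row there, and
-- `Corner⇒height` returns its height to `c`.
φ-Corner : ∀ S → At r c (shape S) → Corner (height c (shape S)) c (shape (φ S))
φ-Corner {c = c} S a =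
  subst (λ d → Corner (height c (shape S)) d (shape (φ S))) (Corner⇒height corner) (columns-Corner (sortedColumns S) (Corner⇒At corner))
  where corner = sortedColumns-Corner S a

-- The row on the right depends on `c` and the shape but not on `r`: φ forgets which row of length
-- `c` was extended.
φ-snocAt : ∀ S x → Bounded x S → At r c (shape S) → φ (snocAt r x S) ≡ snocAt (height c (shape S)) x (φ S)
φ-snocAt S x S≤x a =
  trans (cong columns (sortedColumns-snocAt S x S≤x a)) (columns-snocAt (sortedColumns S) x (sortedColumns-Corner S a))

-- The cell in row r and column c can be added to β, with result α; the side
-- condition, no higher row of length c, is what the triple rule requires.
data Addable : (r c : ℕ) (β α : List ℕ) → Set where
  new   : Addable 0 0 [] (1 ∷ [])
  here  : All (suc c ≢_) β → Addable 0 (suc c) (suc c ∷ β) (suc (suc c) ∷ β)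
  there : Addable r c β α → Addable (suc r) c (b ∷ β) (b ∷ α)

Addable⇒At : Addable r c β α → At r c β
Addable⇒At new       = end
Addable⇒At (here _)  = here
Addable⇒At (there a) = there (Addable⇒At a)

-- Growths and the two tableaux that they build

data Path : ℕ → List ℕ → Set where
  []   : Path 0 []
  step : Path n β → Addable r c β α → Path (suc n) α

label : Path n α → Tableau
label []                       = []
label {suc n} (step {r = r} p a) = snocAt r (suc n) (label p)

-- By `φ-label` this is φ of `label p`. The direct recursion makes the rows of the last letters
-- visible, from which reading words are computed.
tableau : Path n α → Tableau
tableau [] = []
tableau {suc n} (step {β = β} {c = c} p a) = snocAt (height c β) (suc n) (tableau p)

shape-snocAt : ∀ S x → Addable r c β α → shape S ≡ β → shape (snocAt r x S) ≡ α
shape-snocAt []       x new       eq   = refl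
shape-snocAt (R ∷ Rs) x (here _)  eq   =
  cong₂ _∷_ (trans (length-++ R) (trans (+-comm (length R) 1) (cong suc (∷-injectiveˡ eq)))) (∷-injectiveʳ eq)
shape-snocAt (R ∷ Rs) x (there a) eq   = cong₂ _∷_ (∷-injectiveˡ eq) (shape-snocAt Rs x a (∷-injectiveʳ eq))

shape-label : (p : Path n α) → shape (label p) ≡ α
shape-label []                             = refl
shape-label (step p a) = shape-snocAt (label p) _ a (shape-label p)

At-label : (p : Path n β) → Addable r c β α → At r c (shape (label p))
At-label p a = subst (At _ _) (sym (shape-label p)) (Addable⇒At a)

All-snocAt : ∀ {P : ℕ → Set} S → All (All P) S → P x → All (All P) (snocAt r x S)
All-snocAt             []       []       px = (px ∷ []) ∷ []
All-snocAt {r = zero}  (R ∷ Rs) (pR ∷ pS) px = All.++⁺ pR (px ∷ []) ∷ pS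
All-snocAt {r = suc r} (R ∷ Rs) (pR ∷ pS) px = pR ∷ All-snocAt Rs pS px

Bounded-suc : ∀ S → Bounded n S → Bounded (suc n) S
Bounded-suc S = All.map (All.map m≤n⇒m≤1+n)

label-bounded : (p : Path n α) → Bounded n (label p)
label-bounded []         = []
label-bounded (step p a) = All-snocAt (label p) (Bounded-suc (label p) (label-bounded p)) ≤-refl

tableau-bounded : (p : Path n α) → Bounded n (tableau p)
tableau-bounded []         = []
tableau-bounded (step p a) = All-snocAt (tableau p) (Bounded-suc (tableau p) (tableau-bounded p)) ≤-refl

φ-label : (p : Path n α) → φ (label p) ≡ tableau p
φ-label [] = refl
φ-label (step {r = r} {c = c} p a) = trans
  (φ-snocAt (label p) _ (Bounded-suc (label p) (label-bounded p)) (At-label p a))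
  (cong₂ (λ β T → snocAt (height c β) _ T) (shape-label p) (φ-label p))

tableau-Corner : (p : Path n β) → Addable r c β α → Corner (height c β) c (shape (tableau p))
tableau-Corner {β = β} {c = c} p a =
  subst₂ (λ γ T → Corner (height c γ) c (shape T)) (shape-label p) (φ-label p) (φ-Corner (label p) (At-label p a))

sum-Addable : Addable r c β α → sum α ≡ suc (sum β)
sum-Addable new = refl
sum-Addable (here _) = refl
sum-Addable {β = b ∷ β} (there a) = trans (cong (b +_) (sum-Addable a)) (+-suc b (sum β))

sum-Path : Path n α → sum α ≡ n
sum-Path []         = refl
sum-Path (step p a) = trans (sum-Addable a) (cong suc (sum-Path p))

concat-snocAt : ∀ r x S → concat (snocAt r x S) ↭ x ∷ concat S
concat-snocAt r       x []       = ↭-refl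
concat-snocAt zero    x (R ∷ Rs) = ↭-trans (↭-reflexive (++-assoc R [ x ] (concat Rs))) (shift x R (concat Rs))
concat-snocAt (suc r) x (R ∷ Rs) = ↭-trans (++⁺ˡ R (concat-snocAt r x Rs)) (shift x R (concat Rs))

interval-suc : ∀ n → map suc (upTo (suc n)) ↭ suc n ∷ map suc (upTo n)
interval-suc n = begin
  map suc (upTo (suc n))          ≡⟨ cong (map suc) (upTo-∷ʳ n) ⟨
  map suc (upTo n ++ [ n ])       ≡⟨ map-++ suc (upTo n) [ n ] ⟩
  map suc (upTo n) ++ [ suc n ]   ↭⟨ ∷↭∷ʳ (suc n) _ ⟨
  suc n ∷ map suc (upTo n)        ∎
  where open PermutationReasoning

bijective-snocAt : ∀ r S → concat S ↭ map suc (upTo n) → concat (snocAt r (suc n) S) ↭ map suc (upTo (suc n))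
bijective-snocAt {n} r S bij =
  ↭-trans (concat-snocAt r (suc n) S) (↭-trans (prep (suc n) bij) (↭-sym (interval-suc n)))

label-bijective : (p : Path n α) → concat (label p) ↭ map suc (upTo n)
label-bijective []                 = ↭-refl
label-bijective (step {r = r} p a) = bijective-snocAt r (label p) (label-bijective p)

tableau-bijective : (p : Path n α) → concat (tableau p) ↭ map suc (upTo n)
tableau-bijective []                         = ↭-refl
tableau-bijective (step {β = β} {c = c} p a) = bijective-snocAt (height c β) (tableau p) (tableau-bijective p)

-- Growths satisfy the tableau conditions

Increasing : List ℕ → Set
Increasing = Linked _<_

increasing-∷ʳ : Increasing xs → All (_≤ n) xs → Increasing (xs ++ [ suc n ])
increasing-∷ʳ inc xs≤n =
  Linked.AllPairs⇒Linked (AllPairs-∷ʳ (Linked.Linked⇒AllPairs <-trans inc) (All.map s≤s xs≤n))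

increasing-snocAt : ∀ r S → All Increasing S → Bounded n S → All Increasing (snocAt r (suc n) S)
increasing-snocAt r       []       []         []         = [-] ∷ []
increasing-snocAt zero    (R ∷ Rs) (iR ∷ iRs) (bR ∷ bRs) = increasing-∷ʳ iR bR ∷ iRs
increasing-snocAt (suc r) (R ∷ Rs) (iR ∷ iRs) (bR ∷ bRs) = iR ∷ increasing-snocAt r Rs iRs bRs

-- A cell in column 0 can only come from `new`, above all rows.
column-0 : ∀ S x → Addable r 0 (shape S) α → column 0 (snocAt r x S) ≡ column 0 S ++ [ x ]
column-0 []             x new       = refl
column-0 ([] ∷ Rs)      x (there a) = column-0 Rs x a
column-0 ((y ∷ R) ∷ Rs) x (there a) = cong (y ∷_) (column-0 Rs x a)

leftmost-snocAt : ∀ S → Addable r c (shape S) α → Increasing (column 0 S) → Bounded n S →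
  Increasing (column 0 (snocAt r (suc n) S))
leftmost-snocAt {c = zero}  S a inc S≤n = subst Increasing (sym (column-0 S _ a)) (increasing-∷ʳ inc (column-All S S≤n))
leftmost-snocAt {c = suc c} S a inc S≤n = subst Increasing (sym (column-≢ S _ (Addable⇒At a) λ ())) inc

Triple : Tableau → Set
Triple T = ∀ r r′ c x → r < r′ → entry T r (suc c) ≡ just x →
           entry T r′ c ≤⁺ just x → entry T r′ (suc c) <⁺ just x

!?-mono : ∀ (R : List ℕ) → R !? j ≡ just y → (R ++ [ x ]) !? j ≡ just y
!?-mono {j = zero}  (_ ∷ R) eq = eq
!?-mono {j = suc j} (_ ∷ R) eq = !?-mono R eq

!?-inv : ∀ (R : List ℕ) → (R ++ [ x ]) !? j ≡ just y → R !? j ≡ just y ⊎ (j ≡ length R × y ≡ x)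
!?-inv {j = zero}  []      eq = inj₂ (refl , sym (just-injective eq))
!?-inv {j = zero}  (_ ∷ R) eq = inj₁ eq
!?-inv {j = suc j} (_ ∷ R) eq with !?-inv R eq
... | inj₁ eq′          = inj₁ eq′
... | inj₂ (refl , y≡x) = inj₂ (refl , y≡x)

entry-mono : ∀ S r i → entry S i j ≡ just y → entry (snocAt r x S) i j ≡ just y
entry-mono (R ∷ Rs) zero    zero    eq = !?-mono R eq
entry-mono (R ∷ Rs) zero    (suc i) eq = eq
entry-mono (R ∷ Rs) (suc r) zero    eq = eq
entry-mono (R ∷ Rs) (suc r) (suc i) eq = entry-mono Rs r i eq

entry-inv : ∀ S i → At r c (shape S) → entry (snocAt r x S) i j ≡ just y →
  entry S i j ≡ just y ⊎ (i ≡ r × j ≡ c × y ≡ x)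
entry-inv {j = zero} [] zero end eq = inj₂ (refl , refl , sym (just-injective eq))
entry-inv (R ∷ Rs) zero here eq with !?-inv R eq
... | inj₁ eq′        = inj₁ eq′
... | inj₂ (j≡ , y≡x) = inj₂ (refl , j≡ , y≡x)
entry-inv (R ∷ Rs) zero (there a) eq = inj₁ eq
entry-inv (R ∷ Rs) (suc i) here eq = inj₁ eq
entry-inv (R ∷ Rs) (suc i) (there a) eq with entry-inv Rs i a eq
... | inj₁ eq′          = inj₁ eq′
... | inj₂ (refl , eqs) = inj₂ (refl , eqs)

entry-new : ∀ S → At r c (shape S) → entry (snocAt r x S) r c ≡ just x
entry-new []       end       = refl
entry-new (R ∷ Rs) here      = !?-snoc-≡ R _
entry-new (R ∷ Rs) (there a) = entry-new Rs a

!?-All : ∀ {P : ℕ → Set} (R : List ℕ) → All P R → R !? j ≡ just y → P y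
!?-All {j = zero}  (_ ∷ R) (p ∷ _)  refl = p
!?-All {j = suc j} (_ ∷ R) (_ ∷ ps) eq   = !?-All R ps eq

entry-All : ∀ {P : ℕ → Set} S i → All (All P) S → entry S i j ≡ just y → P y
entry-All (R ∷ Rs) zero    (pR ∷ _) eq = !?-All R pR eq
entry-All (R ∷ Rs) (suc i) (_ ∷ ps) eq = entry-All Rs i ps eq

!?-next : ∀ (R : List ℕ) → R !? j ≡ just y → suc j ≢ length R → ∃[ z ] R !? suc j ≡ just z
!?-next {j = zero}  (_ ∷ [])    eq ne = contradiction refl ne
!?-next {j = zero}  (_ ∷ z ∷ R) eq ne = z , refl
!?-next {j = suc j} (_ ∷ R)     eq ne = !?-next R eq (ne ∘ cong suc)

entry-next : ∀ S i → All (suc j ≢_) (shape S) → entry S i j ≡ just y → ∃[ z ] entry S i (suc j) ≡ just z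
entry-next (R ∷ Rs) zero    (ne ∷ _)  eq = !?-next R eq ne
entry-next (R ∷ Rs) (suc i) (_ ∷ nes) eq = entry-next Rs i nes eq

-- By the side condition no row above `r` has length `suc j`, so a row that reaches column `j`
-- continues.
entry-above : ∀ S i → Addable r (suc j) (shape S) α → r < i → entry S i j ≡ just y → ∃[ z ] entry S i (suc j) ≡ just z
entry-above (R ∷ Rs) (suc i) a r<i eq = helper a r<i refl
  where
  -- The length of `R` becomes a variable, so that matching on `here` can unify it with a successor.
  helper : ∀ {r α b} → Addable r (suc _) (b ∷ shape Rs) α → r < suc i → length R ≡ b → ∃[ z ] entry Rs i (suc _) ≡ just z
  helper (here ne) _         _ = entry-next Rs i ne eq
  helper (there a) (s≤s r<i) _ = entry-above Rs i a r<i eq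

≤⁺-just : ∀ {v : Maybe ℕ} → v ≤⁺ just y → ∃[ z ] v ≡ just z × z ≤ y
≤⁺-just NonStrict.[ z≤y ] = _ , refl , z≤y

<⁺-just : ∀ {v : Maybe ℕ} → v <⁺ just y → ∃[ z ] v ≡ just z × z < y
<⁺-just Strict.[ z<y ] = _ , refl , z<y

just-≤⁺ : ∀ {v : Maybe ℕ} → v ≡ just x → x ≤ y → v ≤⁺ just y
just-≤⁺ refl x≤y = NonStrict.[ x≤y ]

just-<⁺ : ∀ {v : Maybe ℕ} → v ≡ just x → x < y → v <⁺ just y
just-<⁺ refl x<y = Strict.[ x<y ]

-- A new instance must have `suc n` as its lower right entry, since as the upper left entry it would
-- exceed an old letter. Then `entry-above` supplies the missing upper right cell, whose letter is
-- at most `n`.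
triple-snocAt : ∀ S → Addable r c (shape S) α → Bounded n S → Triple S → Triple (snocAt r (suc n) S)
triple-snocAt {r} {c} {n = n} S a S≤n tr i i′ j y i<i′ eq v≤ with ≤⁺-just v≤
... | z , eq′ , z≤y with entry-inv S i (Addable⇒At a) eq | entry-inv S i′ (Addable⇒At a) eq′
...   | inj₁ e | inj₁ e′ with _ , e″ , w<y ← <⁺-just (tr i i′ j y i<i′ e (just-≤⁺ e′ z≤y)) =
          just-<⁺ (entry-mono S r i′ e″) w<y
...   | inj₁ e | inj₂ (_ , _ , refl) = contradiction (entry-All S i S≤n e) (<⇒≱ z≤y)
...   | inj₂ (refl , refl , refl) | inj₁ e′ with w , e″ ← entry-above S i′ a i<i′ e′ =
          just-<⁺ (entry-mono S r i′ e″) (s≤s (entry-All S i′ S≤n e″))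
...   | inj₂ (refl , _) | inj₂ (refl , _) = contradiction i<i′ (<-irrefl refl)

label-triple : (p : Path n α) → Triple (label p)
label-triple [] _ _ _ _ _ () _
label-triple (step {r = r} {c = c} {α = α} p a) =
  triple-snocAt (label p) (subst (λ β → Addable r c β α) (sym (shape-label p)) a) (label-bounded p) (label-triple p)

label-leftmost : (p : Path n α) → Increasing (column 0 (label p))
label-leftmost [] = []
label-leftmost (step {r = r} {c = c} {α = α} p a) =
  leftmost-snocAt (label p) (subst (λ β → Addable r c β α) (sym (shape-label p)) a) (label-leftmost p) (label-bounded p)

label-rows : (p : Path n α) → All Increasing (label p)
label-rows []                 = []
label-rows (step {r = r} p a) = increasing-snocAt r (label p) (label-rows p) (label-bounded p)

label-IsSYCT : (p : Path n α) → IsSYCT α (label p)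
label-IsSYCT p = record
  { standard           = record
    { hasShape  = shape-label p
    ; bijective = subst (λ k → concat (label p) ↭ map suc (upTo k)) (sym (sum-Path p)) (label-bijective p)
    }
  ; rowsIncreasing     = label-rows p
  ; leftmostIncreasing = label-leftmost p
  ; triple             = label-triple p
  }

tableau-rows : (p : Path n α) → All Increasing (tableau p)
tableau-rows []                         = []
tableau-rows (step {β = β} {c = c} p a) = increasing-snocAt (height c β) (tableau p) (tableau-rows p) (tableau-bounded p)

tableau-columns : (p : Path n α) → All Increasing (columns (tableau p))
tableau-columns [] = []
tableau-columns (step {c = c} p a) = subst (All Increasing) (sym (columns-snocAt (tableau p) _ (tableau-Corner p a)))
  (increasing-snocAt c (columns (tableau p)) (tableau-columns p) (columns-All (tableau p) (tableau-bounded p)))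

-- The shape of the sorted tableau

Addable-positive : Addable r c β α → IsComposition β → IsComposition α
Addable-positive new       []         = s≤s z≤n ∷ []
Addable-positive (here _)  (_ ∷ ps)   = s≤s z≤n ∷ ps
Addable-positive (there a) (p ∷ ps)   = p ∷ Addable-positive a ps

Path-positive : Path n α → IsComposition α
Path-positive []         = []
Path-positive (step p a) = Addable-positive a (Path-positive p)

-- Adding a cell at the end of a row of length c, up to the order of the rows.
data Enlarge (c : ℕ) (β α : List ℕ) : Set where
  new-part  : c ≡ 0 → α ↭ 1 ∷ β → Enlarge c β α
  grow-part : ∀ γ → β ↭ c ∷ γ → α ↭ suc c ∷ γ → Enlarge c β α

Enlarge-∷ : ∀ b → Enlarge c β α → Enlarge c (b ∷ β) (b ∷ α)
Enlarge-∷ b (new-part c≡0 eq)    = new-part c≡0 (↭-trans (prep b eq) (↭-swap b 1 ↭-refl))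
Enlarge-∷ {c} b (grow-part γ eq eq′) =
  grow-part (b ∷ γ) (↭-trans (prep b eq) (↭-swap b c ↭-refl)) (↭-trans (prep b eq′) (↭-swap b (suc c) ↭-refl))

Enlarge-snocAt : ∀ S x → At r c (shape S) → Enlarge c (shape S) (shape (snocAt r x S))
Enlarge-snocAt []       x end       = new-part refl ↭-refl
Enlarge-snocAt (R ∷ Rs) x here      rewrite length-++ R {[ x ]} | +-comm (length R) 1 = grow-part (shape Rs) ↭-refl ↭-refl
Enlarge-snocAt (R ∷ Rs) x (there a) = Enlarge-∷ (length R) (Enlarge-snocAt Rs x a)

Addable-Enlarge : Addable r c β α → Enlarge c β α
Addable-Enlarge new             = new-part refl ↭-refl
Addable-Enlarge (here {β = β} _) = grow-part β ↭-refl ↭-refl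
Addable-Enlarge (there {b = b} a) = Enlarge-∷ b (Addable-Enlarge a)

-- Cancelling the common part `c` leaves the same remaining parts. A new row on one side and a grown
-- row on the other would make 0 a part, against positivity.
Enlarge-unique : ∀ {β′ α′} → IsComposition β → β ↭ β′ → Enlarge c β α → Enlarge c β′ α′ → α ↭ α′
Enlarge-unique _ p (new-part _ e) (new-part _ e′) = ↭-trans e (↭-trans (prep 1 p) (↭-sym e′))
Enlarge-unique pos p (new-part refl _) (grow-part γ e _) =
  contradiction (All.head (All-resp-↭ (↭-trans p e) pos)) λ ()
Enlarge-unique pos p (grow-part γ e _) (new-part refl _) =
  contradiction (All.head (All-resp-↭ e pos)) λ ()
Enlarge-unique pos p (grow-part γ e f) (grow-part γ′ e′ f′) =
  ↭-trans f (↭-trans (prep _ (drop-∷ (↭-trans (↭-sym e) (↭-trans p e′)))) (↭-sym f′))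

-- At each step both tableaux receive a cell in the same column `c`, which determines the new
-- multiset of row lengths.
shape-tableau-↭ : (p : Path n α) → shape (tableau p) ↭ α
shape-tableau-↭ [] = ↭-refl
shape-tableau-↭ (step p a) =
  ↭-sym (Enlarge-unique (Path-positive p) (↭-sym (shape-tableau-↭ p)) (Addable-Enlarge a)
    (Enlarge-snocAt (tableau p) _ (Corner⇒At (tableau-Corner p a))))

shape-columns-↗ : ∀ S → Linked _≤_ (reverse (shape (columns S)))
shape-columns-↗ S rewrite shape-columns S | reverse-applyUpTo (λ j → height j (shape S)) (width S) =
  Linked.applyDownFrom⁺₂ _ (width S) (λ j → height-antitone (shape S) (n≤1+n j))

-- The rows of φ are columns of another list, so their lengths weakly decrease, and only one
-- rearrangement of `α` does.
shape-tableau : (p : Path n α) → shape (tableau p) ≡ partitionOf α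
shape-tableau p = trans (sym (reverse-involutive _)) (cong reverse (sort≡
  (subst (λ T → Linked _≤_ (reverse (shape T))) (φ-label p) (shape-columns-↗ (sortedColumns (label p))))
  (↭-trans (↭-reverse _) (shape-tableau-↭ p))))

tableau-IsSYT : (p : Path n α) → IsSYT (partitionOf α) (tableau p)
tableau-IsSYT {n} {α} p = record
  { standard          = record
    { hasShape  = shape-tableau p
    ; bijective = subst (λ k → concat (tableau p) ↭ map suc (upTo k)) n≡ (tableau-bijective p)
    }
  ; rowsIncreasing    = tableau-rows p
  ; columnsIncreasing = tableau-columns p
  }
  where
  n≡ : n ≡ sum (partitionOf α)
  n≡ = trans (sym (sum-Path p)) (trans (sym (sum-↭ (shape-tableau-↭ p))) (cong sum (shape-tableau p)))

label-IsLabel : (p : Path n α) → IsLabel α (tableau p) (label p)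
label-IsLabel p = label-IsSYCT p , φ-label p

tableau-Vertex : (p : Path n α) → Vertex (QCS⁺ α) (tableau p)
tableau-Vertex p = tableau-IsSYT p , label p , label-IsLabel p

-- Every composition tableau comes from a growth

last-maximal : ∀ {R} → Increasing R → All (_≤ x) R → x ∈ R → ∃[ R′ ] R ≡ R′ ++ [ x ]
last-maximal [-]         (y≤x ∷ _)         (here refl) = [] , refl
last-maximal (y<z ∷ _)   (_ ∷ z≤x ∷ _)     (here refl) = contradiction y<z (≤⇒≯ z≤x)
last-maximal {R = y ∷ _} (_ ∷ inc) (_ ∷ bs) (there x∈R) with R′ , eq ← last-maximal inc bs x∈R = y ∷ R′ , cong (y ∷_) eq

!?-last : ∀ (R : List ℕ) → suc k ≡ length R → ∃[ z ] R !? k ≡ just z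
!?-last {zero}  (z ∷ R) eq = z , refl
!?-last {suc k} (_ ∷ R) eq = !?-last R (suc-injective eq)

-- Converse of `entry-next`: it turns the conclusion of the triple rule into the side condition of
-- `Addable`.
no-row : ∀ S → (∀ i {z} → entry S i k ≡ just z → ∃[ w ] entry S i (suc k) ≡ just w) → All (suc k ≢_) (shape S)
no-row []       next = []
no-row (R ∷ Rs) next = ne ∷ no-row Rs (λ i → next (suc i))
  where
  ne : suc _ ≢ length R
  ne eq with z , e ← !?-last R eq with w , e′ ← next 0 e with () ← trans (sym e′) (!?-≥ R (≤-reflexive (sym eq)))

record Peeled (x : ℕ) (T : Tableau) : Set where
  constructor peeled
  field
    {row# col#} : ℕ
    rest    : Tableau
    addable : Addable row# col# (shape rest) (shape T)
    added   : T ≡ snocAt row# x rest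

-- The largest letter ends its row. If it is alone there, a row above would start with a larger
-- letter, so its row is the top one. Otherwise the triple rule, with `x` as right entry, continues
-- every higher row that has a cell in the column before `x`; hence none of them blocks `x`.
peel : ∀ T → IsComposition (shape T) → All Increasing T → Increasing (column 0 T) → Triple T →
  Bounded x T → x ∈ concat T → Peeled x T
peel (R ∷ Rs) (_ ∷ pos) (inc ∷ incs) left tr (R≤x ∷ S≤x) x∈T with ∈-++⁻ R x∈T
peel ((y ∷ R) ∷ Rs) (_ ∷ pos) (inc ∷ incs) left tr (R≤x ∷ S≤x) x∈T | inj₂ x∈Rs
  with peeled S a eq ← peel Rs pos incs (tail left) (λ i i′ j z i<i′ → tr (suc i) (suc i′) j z (s≤s i<i′)) S≤x x∈Rs
  = peeled ((y ∷ R) ∷ S) (there a) (cong (_ ∷_) eq)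
peel (R ∷ Rs) (_ ∷ pos) (inc ∷ incs) left tr (R≤x ∷ S≤x) x∈T | inj₁ x∈R with last-maximal inc R≤x x∈R
peel (_ ∷ []) _ _ _ _ _ _ | inj₁ _ | [] , refl = peeled [] new refl
peel (_ ∷ [] ∷ _) (_ ∷ () ∷ _) _ _ _ _ _ | inj₁ _ | [] , refl
peel (_ ∷ (y ∷ _) ∷ _) _ _ (x<y ∷ _) _ (_ ∷ (y≤x ∷ _) ∷ _) _ | inj₁ _ | [] , refl = contradiction x<y (≤⇒≯ y≤x)
peel {x} (_ ∷ Rs) _ _ _ tr (_ ∷ S≤x) _ | inj₁ _ | R@(y ∷ ys) , refl =
  peeled (R ∷ Rs) (subst (λ l → Addable 0 (length R) (shape (R ∷ Rs)) (l ∷ shape Rs)) (sym len) (here (no-row Rs next))) refl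
  where
  len : length (R ++ [ x ]) ≡ suc (length R)
  len = trans (length-++ R) (+-comm (length R) 1)
  next : ∀ i {z} → entry Rs i (length ys) ≡ just z → ∃[ w ] entry Rs i (length R) ≡ just w
  next i e with w , e′ , _ ← <⁺-just (tr 0 (suc i) (length ys) x z<s (!?-snoc-≡ R x) (just-≤⁺ e (entry-All Rs i S≤x e)))
    = w , e′

Linked-++⁻ˡ : ∀ {R : ℕ → ℕ → Set} xs → Linked R (xs ++ ys) → Linked R xs
Linked-++⁻ˡ []           _        = []
Linked-++⁻ˡ (x ∷ [])     _        = [-]
Linked-++⁻ˡ (x ∷ y ∷ xs) (p ∷ ps) = p ∷ Linked-++⁻ˡ (y ∷ xs) ps

increasing-snocAt⁻ : ∀ r S → All Increasing (snocAt r x S) → All Increasing S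
increasing-snocAt⁻ r       []       _          = []
increasing-snocAt⁻ zero    (R ∷ Rs) (iR ∷ iRs) = Linked-++⁻ˡ R iR ∷ iRs
increasing-snocAt⁻ (suc r) (R ∷ Rs) (iR ∷ iRs) = iR ∷ increasing-snocAt⁻ r Rs iRs

leftmost-snocAt⁻ : ∀ S → Addable r c (shape S) α → Increasing (column 0 (snocAt r x S)) → Increasing (column 0 S)
leftmost-snocAt⁻ {c = zero}  S a inc = Linked-++⁻ˡ (column 0 S) (subst Increasing (column-0 S _ a) inc)
leftmost-snocAt⁻ {c = suc c} S a inc = subst Increasing (column-≢ S _ (Addable⇒At a) λ ()) inc

-- The upper right entry provided by the rule is less than an old letter, so it is not the removed
-- `suc n`.
triple-snocAt⁻ : ∀ S → At r c (shape S) → Bounded n S → Triple (snocAt r (suc n) S) → Triple S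
triple-snocAt⁻ {r} {n = n} S a S≤n tr i i′ j y i<i′ e v≤
  with z , e′ , z≤y ← ≤⁺-just v≤
  with w , e″ , w<y ← <⁺-just (tr i i′ j y i<i′ (entry-mono S r i e) (just-≤⁺ (entry-mono S r i′ e′) z≤y))
  with entry-inv S i′ a e″
... | inj₁ e‴              = just-<⁺ e‴ w<y
... | inj₂ (_ , _ , refl) = contradiction (m≤n⇒m≤1+n (entry-All S i S≤n e)) (<⇒≱ w<y)

Addable-positive⁻ : Addable r c β α → IsComposition α → IsComposition β
Addable-positive⁻ new       _        = []
Addable-positive⁻ (here _)  (_ ∷ ps) = s≤s z≤n ∷ ps
Addable-positive⁻ (there a) (p ∷ ps) = p ∷ Addable-positive⁻ a ps

interval-≤ : ∀ n → All (_≤ n) (map suc (upTo n))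
interval-≤ n = All.map⁺ (All.applyUpTo⁺₁ id n id)

bounded : ∀ S → concat S ↭ map suc (upTo n) → Bounded n S
bounded {n} S bij = All.concat⁻ (All-resp-↭ (↭-sym bij) (interval-≤ n))

label-surjective′ : ∀ n T → IsComposition (shape T) → concat T ↭ map suc (upTo n) → All Increasing T →
  Increasing (column 0 T) → Triple T → ∃[ p ] label {n} {shape T} p ≡ T
label-surjective′ zero    []             _        _   _   _    _ = [] , refl
label-surjective′ zero    ([] ∷ _)       (() ∷ _) _   _   _    _
label-surjective′ zero    ((_ ∷ _) ∷ _)  _        bij _   _    _ with () ← ↭-length bij
label-surjective′ (suc n) T pos bij inc left tr
  with bij′ ← ↭-trans bij (interval-suc n)
  with peeled {r} S a eq ← peel T pos inc left tr (bounded T bij) (∈-resp-↭ (↭-sym bij′) (here refl))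
  = extend eq (label-surjective′ n S (Addable-positive⁻ a pos) bijS
      (increasing-snocAt⁻ r S (subst (All Increasing) eq inc))
      (leftmost-snocAt⁻ S a (subst (Increasing ∘ column 0) eq left))
      (triple-snocAt⁻ S (Addable⇒At a) (bounded S bijS) (subst Triple eq tr)))
  where
  bijS : concat S ↭ map suc (upTo n)
  bijS = drop-∷ (↭-trans (↭-sym (concat-snocAt r (suc n) S)) (subst (λ T → concat T ↭ _) eq bij′))
  extend : T ≡ snocAt r (suc n) S → ∃[ p ] label {n} {shape S} p ≡ S → ∃[ p ] label {suc n} {shape T} p ≡ T
  extend eq (p , eq′) = step p a , trans (cong (snocAt r (suc n)) eq′) (sym eq)

label-surjective : ∀ {T} → IsComposition α → IsSYCT α T → ∃[ p ] label {sum α} {α} p ≡ T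
label-surjective {T = T} pos record { standard = record { hasShape = refl ; bijective = bij }
                                     ; rowsIncreasing = inc ; leftmostIncreasing = left ; triple = tr } =
  label-surjective′ _ T pos bij inc left tr

-- Reading words restricted to the last letters

row-∷ : ∀ R Rs → row (R ∷ Rs) ≡ row Rs ++ R
row-∷ R Rs = begin
  concat (reverse (R ∷ Rs))           ≡⟨ cong concat (unfold-reverse R Rs) ⟩
  concat (reverse Rs ++ [ R ])        ≡⟨ concat-++ (reverse Rs) [ R ] ⟨
  row Rs ++ (R ++ [])                 ≡⟨ cong (row Rs ++_) (++-identityʳ R) ⟩
  row Rs ++ R                         ∎
  where open ≡-Reasoning

module Reading {P : ℕ → Set} (P? : Decidable P) where

  word : Tableau → List ℕ
  word T = filter P? (row T)

  Hidden : Tableau → Set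
  Hidden = All (All (¬_ ∘ P))

  word-∷ : ∀ R Rs → word (R ∷ Rs) ≡ word Rs ++ filter P? R
  word-∷ R Rs = trans (cong (filter P?) (row-∷ R Rs)) (filter-++ P? (row Rs) R)

  filter-∷ʳ : ∀ R → P x → All (¬_ ∘ P) R → filter P? (R ++ [ x ]) ≡ [ x ]
  filter-∷ʳ R px hR = trans (filter-++ P? R _) (cong₂ _++_ (filter-none P? hR) (filter-accept P? px))

  filter-∷ʳ-hidden : ∀ R → ¬ P x → filter P? (R ++ [ x ]) ≡ filter P? R
  filter-∷ʳ-hidden R ¬px =
    trans (filter-++ P? R _) (trans (cong (filter P? R ++_) (filter-reject P? ¬px)) (++-identityʳ _))

  word-∷-hidden : ∀ {R Rs} → All (¬_ ∘ P) R → word (R ∷ Rs) ≡ word Rs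
  word-∷-hidden {R} {Rs} hR =
    trans (word-∷ R Rs) (trans (cong (word Rs ++_) (filter-none P? hR)) (++-identityʳ _))

  word-hidden : Hidden T → word T ≡ []
  word-hidden []       = refl
  word-hidden {_ ∷ Rs} (hR ∷ hT) = trans (word-∷-hidden {Rs = Rs} hR) (word-hidden hT)

  word-snocAt-hidden : ∀ r T → ¬ P x → word (snocAt r x T) ≡ word T
  word-snocAt-hidden r       []       ¬px = filter-reject P? ¬px
  word-snocAt-hidden zero    (R ∷ Rs) ¬px =
    trans (word-∷ _ Rs) (trans (cong (word Rs ++_) (filter-∷ʳ-hidden R ¬px)) (sym (word-∷ R Rs)))
  word-snocAt-hidden (suc r) (R ∷ Rs) ¬px =
    trans (word-∷ R (snocAt r _ Rs)) (trans (cong (_++ filter P? R) (word-snocAt-hidden r Rs ¬px)) (sym (word-∷ R Rs)))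

  word₁ : ∀ r → Hidden T → P x → word (snocAt r x T) ≡ [ x ]
  word₁ r []                   px = filter-accept P? px
  word₁ {R ∷ Rs} zero    (hR ∷ hT) px = trans (word-∷ _ Rs) (cong₂ _++_ (word-hidden hT) (filter-∷ʳ R px hR))
  word₁ {_ ∷ Rs} (suc r) (hR ∷ hT) px = trans (word-∷-hidden {Rs = snocAt r _ Rs} hR) (word₁ r hT px)

  -- `x` is read first, being higher than `y` or earlier in the same row. The bound `p ≤ length T`
  -- matters: beyond it `snocAt` would put `x` in a lower row than `p`, and `y` could end up above
  -- it.
  word-ascent : Hidden T → q ≤ p → p ≤ length T → P x → P y → word (snocAt q y (snocAt p x T)) ≡ x ∷ y ∷ []
  word-ascent [] z≤n z≤n px py = trans (filter-accept P? px) (cong (_ ∷_) (filter-accept P? py))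
  word-ascent {R ∷ Rs} {p = zero} (hR ∷ hT) z≤n p≤ px py = trans (word-∷ _ Rs) (cong₂ _++_ (word-hidden hT)
    (trans (filter-++ P? (R ++ [ _ ]) _) (cong₂ _++_ (filter-∷ʳ R px hR) (filter-accept P? py))))
  word-ascent {R ∷ Rs} {p = suc p} (hR ∷ hT) z≤n p≤ px py =
    trans (word-∷ _ (snocAt p _ Rs)) (cong₂ _++_ (word₁ p hT px) (filter-∷ʳ R py hR))
  word-ascent {R ∷ Rs} (hR ∷ hT) (s≤s q≤p) (s≤s p≤) px py =
    trans (word-∷-hidden {Rs = snocAt _ _ (snocAt _ _ Rs)} hR) (word-ascent hT q≤p p≤ px py)

  word-descent : Hidden T → p ≤ length T → P x → P z → word (snocAt (suc p) z (snocAt p x T)) ≡ z ∷ x ∷ []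
  word-descent [] z≤n px pz = trans (filter-accept P? pz) (cong (_ ∷_) (filter-accept P? px))
  word-descent {R ∷ Rs} {p = zero} (hR ∷ hT) p≤ px pz =
    trans (word-∷ _ (snocAt 0 _ Rs)) (cong₂ _++_ (word₁ 0 hT pz) (filter-∷ʳ R px hR))
  word-descent {R ∷ Rs} {p = suc p} (hR ∷ hT) (s≤s p≤) px pz =
    trans (word-∷-hidden {Rs = snocAt (suc p) _ (snocAt p _ Rs)} hR) (word-descent hT p≤ px pz)

  word-312 : Hidden T → q ≤ p → p ≤ length T → P x → P y → P z →
    word (snocAt (suc p) z (snocAt q y (snocAt p x T))) ≡ z ∷ x ∷ y ∷ []
  word-312 [] z≤n z≤n px py pz = trans (filter-accept P? pz)
    (cong (_ ∷_) (trans (filter-accept P? px) (cong (_ ∷_) (filter-accept P? py))))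
  word-312 {R ∷ Rs} {p = zero} (hR ∷ hT) z≤n p≤ px py pz = trans (word-∷ _ (snocAt 0 _ Rs)) (cong₂ _++_ (word₁ 0 hT pz)
    (trans (filter-++ P? (R ++ [ _ ]) _) (cong₂ _++_ (filter-∷ʳ R px hR) (filter-accept P? py))))
  word-312 {R ∷ Rs} {p = suc p} (hR ∷ hT) z≤n (s≤s p≤) px py pz =
    trans (word-∷ _ (snocAt (suc p) _ (snocAt p _ Rs))) (cong₂ _++_ (word-descent hT p≤ px pz) (filter-∷ʳ R py hR))
  word-312 {R ∷ Rs} (hR ∷ hT) (s≤s q≤p) (s≤s p≤) px py pz =
    trans (word-∷-hidden {Rs = snocAt _ _ (snocAt _ _ (snocAt _ _ Rs))} hR) (word-312 hT q≤p p≤ px py pz)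

  -- As `suc q ≤ p`, the letter `z` is added below `x` or behind it in the same row, and directly
  -- above the row of `y`.
  word-132 : Hidden T → q < p → p ≤ length T → P x → P y → P z →
    word (snocAt (suc q) z (snocAt q y (snocAt p x T))) ≡ x ∷ z ∷ y ∷ []
  word-132 {R ∷ Rs} {q = zero} {p = suc p} (hR ∷ hT) _ (s≤s p≤) px py pz =
    trans (word-∷ _ (snocAt 0 _ (snocAt p _ Rs))) (cong₂ _++_ (word-ascent hT z≤n p≤ px pz) (filter-∷ʳ R py hR))
  word-132 {R ∷ Rs} {q = suc q} (hR ∷ hT) (s≤s q<p) (s≤s p≤) px py pz =
    trans (word-∷-hidden {Rs = snocAt _ _ (snocAt _ _ (snocAt _ _ Rs))} hR) (word-132 hT q<p p≤ px py pz)

open Reading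

-- Crystal edges on the three last letters

-- Row `p` has to exist already, as the order in which new rows are opened does matter.
snocAt-comm : ∀ S → p < length S → p ≢ q → snocAt q y (snocAt p x S) ≡ snocAt p x (snocAt q y S)
snocAt-comm {zero}  {zero}  (R ∷ Rs) p<     p≢q = contradiction refl p≢q
snocAt-comm {zero}  {suc q} (R ∷ Rs) p<     p≢q = refl
snocAt-comm {suc p} {zero}  (R ∷ Rs) p<     p≢q = refl
snocAt-comm {suc p} {suc q} (R ∷ Rs) (s≤s p<) p≢q = cong (R ∷_) (snocAt-comm Rs p< (p≢q ∘ cong suc))

length-snocAt : ∀ S → p ≤ length S → p < length (snocAt p x S)
length-snocAt {zero}  []       _        = s≤s z≤n
length-snocAt {zero}  (_ ∷ _)  _        = s≤s z≤n
length-snocAt {suc p} (_ ∷ Rs) (s≤s p≤) = s≤s (length-snocAt Rs p≤)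

map-snocAt : ∀ (f : ℕ → ℕ) r x S → map (map f) (snocAt r x S) ≡ snocAt r (f x) (map (map f) S)
map-snocAt f r       x []       = refl
map-snocAt f zero    x (R ∷ Rs) = cong (_∷ _) (map-++ f R [ x ])
map-snocAt f (suc r) x (R ∷ Rs) = cong (_ ∷_) (map-snocAt f r x Rs)

map-map-fixed : ∀ {f : ℕ → ℕ} S → All (All (λ y → f y ≡ y)) S → map (map f) S ≡ S
map-map-fixed []       []        = refl
map-map-fixed (R ∷ Rs) (eq ∷ eqs) = cong₂ _∷_ (fixed R eq) (map-map-fixed Rs eqs)
  where
  fixed : ∀ R → All _ R → map _ R ≡ R
  fixed []      []         = refl
  fixed (y ∷ R) (eq ∷ eqs) = cong₂ _∷_ eq (fixed R eqs)

cycleLetter-< : x < k → cycleLetter k m x ≡ x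
cycleLetter-< {x} {k} {m} x<k with x ≟ k
... | yes refl = contradiction x<k (<-irrefl refl)
... | no _ with k <? x
...   | yes k<x = contradiction k<x (<-asym x<k)
...   | no _    = refl

cycleLetter-> : k + m < x → cycleLetter k m x ≡ x
cycleLetter-> {k} {m} {x} k+m<x with x ≟ k
... | yes refl = contradiction (m≤m+n x m) (<⇒≱ k+m<x)
... | no _ with k <? x
...   | no _ = refl
...   | yes _ with x ≤? k + m
...     | yes x≤ = contradiction k+m<x (≤⇒≯ x≤)
...     | no _   = refl

cycleLetter-≡ : ∀ k → cycleLetter k 1 k ≡ suc k
cycleLetter-≡ k with k ≟ k
... | yes _  = +-comm k 1
... | no k≢k = contradiction refl k≢k

cycleLetter-suc : ∀ k → cycleLetter k 1 (suc k) ≡ k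
cycleLetter-suc k with suc k ≟ k
... | yes ()
... | no _ with k <? suc k
...   | no k≮ = contradiction ≤-refl k≮
...   | yes _ with suc k ≤? k + 1
...     | yes _ = refl
...     | no ≰  = contradiction (≤-reflexive (+-comm 1 k)) ≰

swapLetters-≢ : x ≢ i → x ≢ j → swapLetters i j x ≡ x
swapLetters-≢ {x} {i} {j} x≢i x≢j with x ≟ i
... | yes x≡i = contradiction x≡i x≢i
... | no _ with x ≟ j
...   | yes x≡j = contradiction x≡j x≢j
...   | no _    = refl

swapLetters-ˡ : ∀ i j → swapLetters i j i ≡ j
swapLetters-ˡ i j with i ≟ i
... | yes _  = refl
... | no i≢i = contradiction refl i≢i

swapLetters-ʳ : ∀ i → swapLetters i (suc i) (suc i) ≡ i
swapLetters-ʳ i with suc i ≟ i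
... | yes ()
... | no _ with suc i ≟ suc i
...   | yes _ = refl
...   | no ≢  = contradiction refl ≢

unpairedClosed-open : ∀ d xs → b < x → unpairedClosed d b (x ∷ xs) ≡ unpairedClosed (suc d) b xs
unpairedClosed-open {b} {x} d xs b<x with b <? x
... | yes _  = refl
... | no b≮x = contradiction b<x b≮x

unpairedClosed-unpaired : ∀ xs → x ≤ b → unpairedClosed 0 b (x ∷ xs) ≡ x ∷ unpairedClosed 0 b xs
unpairedClosed-unpaired {x} {b} xs x≤b with b <? x
... | yes b<x = contradiction b<x (≤⇒≯ x≤b)
... | no _    = refl

unpairedClosed-paired : ∀ d xs → x ≤ b → unpairedClosed (suc d) b (x ∷ xs) ≡ unpairedClosed d b xs
unpairedClosed-paired {x} {b} d xs x≤b with b <? x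
... | yes b<x = contradiction b<x (≤⇒≯ x≤b)
... | no _    = refl

-- Bounds the letter `k` of an edge by `i + m`.
unpairedClosed-≤ : ∀ d b xs → All (_≤ b) (unpairedClosed d b xs)
unpairedClosed-≤ d b [] = []
unpairedClosed-≤ d b (x ∷ xs) with b <? x | d
... | yes _  | _     = unpairedClosed-≤ _ b xs
... | no b≮x | zero  = ≮⇒≥ b≮x ∷ unpairedClosed-≤ zero b xs
... | no _   | suc d′ = unpairedClosed-≤ d′ b xs

insertRow-< : ∀ ys → x < y → insertRow x (y ∷ ys) ≡ (x ∷ ys , just y)
insertRow-< {x} {y} ys x<y with x <? y
... | yes _  = refl
... | no x≮y = contradiction x<y x≮y

insertRow-> : ∀ ys → y < x → insertRow x (y ∷ ys) ≡ map₁ (y ∷_) (insertRow x ys)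
insertRow-> {y} {x} ys y<x with x <? y
... | yes x<y = contradiction x<y (<-asym y<x)
... | no _    = refl

insertion-12 : x < y → insertionTableau (x ∷ y ∷ []) ≡ (x ∷ y ∷ []) ∷ []
insertion-12 x<y rewrite insertRow-> [] x<y = refl

insertion-312 : x < y → y < z → insertionTableau (z ∷ x ∷ y ∷ []) ≡ (x ∷ y ∷ []) ∷ (z ∷ []) ∷ []
insertion-312 x<y y<z rewrite insertRow-< [] (<-trans x<y y<z) | insertRow-> [] x<y = refl

insertion-132 : x < y → y < z → insertionTableau (x ∷ z ∷ y ∷ []) ≡ (x ∷ y ∷ []) ∷ (z ∷ []) ∷ []
insertion-132 {x} {y} {z} x<y y<z rewrite insertRow-> [] (<-trans x<y y<z) | insertRow-> [ z ] x<y | insertRow-< [] y<z = refl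

module _ (n : ℕ) where

  private
    whole : ∀ x → Dec (suc n ≤ x × x ≤ suc n + 2 * 1)
    whole x = (suc n ≤? x) ×-dec (x ≤? suc n + 2 * 1)

    half : ∀ x → Dec (suc n ≤ x × x ≤ suc n + 1)
    half x = (suc n ≤? x) ×-dec (x ≤? suc n + 1)

    top≡ : suc n + 2 * 1 ≡ 3 + n
    top≡ = cong suc (+-comm n 2)

    mid≡ : suc n + 1 ≡ 2 + n
    mid≡ = cong suc (+-comm n 1)

    in-whole : suc n ≤ x → x ≤ 3 + n → suc n ≤ x × x ≤ suc n + 2 * 1
    in-whole {x} n<x x≤ = n<x , subst (x ≤_) (sym top≡) x≤

    in-half : suc n ≤ x → x ≤ 2 + n → suc n ≤ x × x ≤ suc n + 1
    in-half {x} n<x x≤ = n<x , subst (x ≤_) (sym mid≡) x≤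

    top-not-half : ¬ (suc n ≤ 3 + n × 3 + n ≤ suc n + 1)
    top-not-half (_ , ≤mid) = <-irrefl refl (subst (3 + n ≤_) mid≡ ≤mid)

    hidden-whole : Bounded n T → Hidden whole T
    hidden-whole = All.map (All.map λ x≤n (n<x , _) → <⇒≱ n<x x≤n)

    hidden-half : Bounded n T → Hidden half T
    hidden-half = All.map (All.map λ x≤n (n<x , _) → <⇒≱ n<x x≤n)

    dyck : ∀ {T w} → size T ≡ 3 + n → word whole T ≡ w → shape (insertionTableau w) ≡ 2 ∷ 1 ∷ [] →
      word half T ≡ suc n ∷ 2 + n ∷ [] → IsDyckPatternInterval T (suc n) 1
    dyck eq eqw ins eqh = record
      { m≥1         = ≤-refl
      ; lower       = s≤s z≤n
      ; upper       = ≤-reflexive (trans top≡ (sym eq))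
      ; shape-whole = trans (cong (shape ∘ insertionTableau) eqw) ins
      ; shape-half  = trans (cong (shape ∘ insertionTableau) eqh) (cong shape (insertion-12 (n<1+n (suc n))))
      }

    closed-< : ∀ {x} → x ≤ 2 + n → x ≤ suc n + 1
    closed-< {x} = subst (x ≤_) (sym mid≡)

    open-> : suc n + 1 < 3 + n
    open-> = ≤-reflexive (cong suc mid≡)

    cycle-fixed : Bounded n T → n < k → map (map (cycleLetter k 1)) T ≡ T
    cycle-fixed {T} T≤n n<k = map-map-fixed T (All.map (All.map λ x≤n → cycleLetter-< (≤-<-trans x≤n n<k)) T≤n)

  -- Writing 1, 2, 3 for the last letters, the word is 3 1 2. The bracket opened by 3 is closed by
  -- 1, so `k` is 2, and for `m = 1` the action is the transposition of 2 and 3, which gives 2 1 3.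
  CSEdge-312 : ∀ G → Bounded n G → q ≤ p → p ≤ length G →
    size (snocAt (suc p) (3 + n) (snocAt q (2 + n) (snocAt p (1 + n) G))) ≡ 3 + n →
    CSEdge (snocAt (suc p) (3 + n) (snocAt q (2 + n) (snocAt p (1 + n) G)))
           (snocAt q (3 + n) (snocAt (suc p) (2 + n) (snocAt p (1 + n) G)))
  CSEdge-312 {q} {p} G G≤n q≤p p≤ eq =
    suc n , 1 , 2 + n ,
    dyck eq w312 (cong shape (insertion-312 (n<1+n (1 + n)) (n<1+n (2 + n))))
      (trans (word-snocAt-hidden half (suc p) (snocAt q (2 + n) (snocAt p (1 + n) G)) top-not-half)
        (word-ascent half (hidden-half G≤n) q≤p p≤ (in-half ≤-refl (n≤1+n _)) (in-half (n≤1+n _) ≤-refl))) ,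
    trans (cong (unpairedClosed 0 (suc n + 1)) w312)
      (trans (unpairedClosed-open 0 _ open->)
      (trans (unpairedClosed-paired 0 _ (closed-< (n≤1+n _))) (unpairedClosed-unpaired [] (closed-< ≤-refl)))) ,
    sym (begin
      map (map f) (snocAt (suc p) (3 + n) (snocAt q (2 + n) (snocAt p (1 + n) G)))
        ≡⟨ map-snocAt f (suc p) _ _ ⟩
      snocAt (suc p) (f (3 + n)) (map (map f) (snocAt q (2 + n) (snocAt p (1 + n) G)))
        ≡⟨ cong₂ (snocAt (suc p)) (cycleLetter-suc (2 + n)) (map-snocAt f q _ _) ⟩
      snocAt (suc p) (2 + n) (snocAt q (f (2 + n)) (map (map f) (snocAt p (1 + n) G)))
        ≡⟨ cong (snocAt (suc p) (2 + n)) (cong₂ (snocAt q) (cycleLetter-≡ (2 + n)) (map-snocAt f p _ _)) ⟩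
      snocAt (suc p) (2 + n) (snocAt q (3 + n) (snocAt p (f (1 + n)) (map (map f) G)))
        ≡⟨ cong (snocAt (suc p) (2 + n) ∘ snocAt q (3 + n)) (cong₂ (snocAt p) (cycleLetter-< (n<1+n _)) (cycle-fixed G≤n (m≤n⇒m≤1+n (n<1+n _)))) ⟩
      snocAt (suc p) (2 + n) (snocAt q (3 + n) (snocAt p (1 + n) G))
        ≡⟨ snocAt-comm _ (≤-<-trans q≤p (length-snocAt G p≤)) (<⇒≢ (s≤s q≤p)) ⟩
      snocAt q (3 + n) (snocAt (suc p) (2 + n) (snocAt p (1 + n) G)) ∎)
    where
    open ≡-Reasoning
    f = cycleLetter (2 + n) 1
    w312 = word-312 whole (hidden-whole G≤n) q≤p p≤ (in-whole ≤-refl (m≤n⇒m≤1+n (n≤1+n _)))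
      (in-whole (n≤1+n _) (n≤1+n _)) (in-whole (m≤n⇒m≤1+n (n≤1+n _)) ≤-refl)

  -- In 1 3 2 the letter 1 precedes the only open bracket, so `k` is 1. Exchanging 1 and 2 gives 2 3
  -- 1.
  CSEdge-132 : ∀ G → Bounded n G → q < p → p ≤ length G →
    size (snocAt (suc q) (3 + n) (snocAt q (2 + n) (snocAt p (1 + n) G))) ≡ 3 + n →
    CSEdge (snocAt (suc q) (3 + n) (snocAt q (2 + n) (snocAt p (1 + n) G)))
           (snocAt (suc q) (3 + n) (snocAt p (2 + n) (snocAt q (1 + n) G)))
  CSEdge-132 {q} {p} G G≤n q<p p≤ eq =
    suc n , 1 , 1 + n ,
    dyck eq w132 (cong shape (insertion-132 (n<1+n (1 + n)) (n<1+n (2 + n))))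
      (trans (word-snocAt-hidden half (suc q) (snocAt q (2 + n) (snocAt p (1 + n) G)) top-not-half)
        (word-ascent half (hidden-half G≤n) (<⇒≤ q<p) p≤ (in-half ≤-refl (n≤1+n _)) (in-half (n≤1+n _) ≤-refl))) ,
    trans (cong (unpairedClosed 0 (suc n + 1)) w132)
      (trans (unpairedClosed-unpaired _ (closed-< (n≤1+n _)))
        (cong (suc n ∷_) (trans (unpairedClosed-open 0 _ open->) (unpairedClosed-paired 0 _ (closed-< ≤-refl))))) ,
    sym (begin
      map (map f) (snocAt (suc q) (3 + n) (snocAt q (2 + n) (snocAt p (1 + n) G)))
        ≡⟨ map-snocAt f (suc q) _ _ ⟩
      snocAt (suc q) (f (3 + n)) (map (map f) (snocAt q (2 + n) (snocAt p (1 + n) G)))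
        ≡⟨ cong₂ (snocAt (suc q)) (cycleLetter-> {1 + n} {1} open->) (map-snocAt f q _ _) ⟩
      snocAt (suc q) (3 + n) (snocAt q (f (2 + n)) (map (map f) (snocAt p (1 + n) G)))
        ≡⟨ cong (snocAt (suc q) (3 + n)) (cong₂ (snocAt q) (cycleLetter-suc (1 + n)) (map-snocAt f p _ _)) ⟩
      snocAt (suc q) (3 + n) (snocAt q (1 + n) (snocAt p (f (1 + n)) (map (map f) G)))
        ≡⟨ cong (snocAt (suc q) (3 + n) ∘ snocAt q (1 + n)) (cong₂ (snocAt p) (cycleLetter-≡ (1 + n)) (cycle-fixed G≤n (n<1+n _))) ⟩
      snocAt (suc q) (3 + n) (snocAt q (1 + n) (snocAt p (2 + n) G))
        ≡⟨ cong (snocAt (suc q) (3 + n)) (snocAt-comm G (<-≤-trans q<p p≤) (<⇒≢ q<p)) ⟨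
      snocAt (suc q) (3 + n) (snocAt p (2 + n) (snocAt q (1 + n) G)) ∎)
    where
    open ≡-Reasoning
    f = cycleLetter (1 + n) 1
    w132 = word-132 whole (hidden-whole G≤n) q<p p≤ (in-whole ≤-refl (m≤n⇒m≤1+n (n≤1+n _)))
      (in-whole (n≤1+n _) (n≤1+n _)) (in-whole (m≤n⇒m≤1+n (n≤1+n _)) ≤-refl)

-- Knuth relations on sequences of columns

size-tableau : (p : Path n α) → size (tableau p) ≡ n
size-tableau p = trans (sum-↭ (shape-tableau-↭ p)) (sum-Path p)

height-Addable-≢ : Addable r c β α → j ≢ c → height j α ≡ height j β
height-Addable-≢ {j = zero} new j≢c = contradiction refl j≢c
height-Addable-≢ {j = suc j} new j≢c = refl
height-Addable-≢ (here {β = β} _) j≢c = cong (_+ height _ β) (indicator-suc j≢c)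
height-Addable-≢ (there a) j≢c = cong (_ +_) (height-Addable-≢ a j≢c)

height-Addable-≡ : Addable r c β α → height c α ≡ suc (height c β)
height-Addable-≡ new = refl
height-Addable-≡ {c = c} (here {β = β} _) =
  cong (_+ height c β) (trans (indicator-< (n<1+n c)) (cong suc (sym (indicator-≥ (≤-refl {c})))))
height-Addable-≡ {c = c} (there {β = β} {b = b} a) = trans (cong (_ +_) (height-Addable-≡ a)) (+-suc (indicator c b) (height c β))

height≤length : (p : Path n β) → Addable r c β α → height c β ≤ length (tableau p)
height≤length {β = β} {c = c} p a = subst (height c β ≤_) (length-map length (tableau p)) (At⇒≤length (Corner⇒At (tableau-Corner p a)))

-- In a path the letter n has column c if the n-th step adds a cell in column c:
-- the next two lemmas are the Knuth relations c c+1 c ~ c c c+1 and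
-- c c+1 c+1 ~ c+1 c c+1 on the word of columns.
Knuth-312 : (g : Path n γ) (a₁ : Addable r₁ c γ β₁) (a₂ : Addable r₂ (suc c) β₁ β₂) (a₃ : Addable r₃ c β₂ α)
  (b₁ : Addable s₁ c γ δ₁) (b₂ : Addable s₂ c δ₁ δ₂) (b₃ : Addable s₃ (suc c) δ₂ α) →
  CSEdge (tableau (step (step (step g a₁) a₂) a₃)) (tableau (step (step (step g b₁) b₂) b₃))
Knuth-312 {n} {γ} {c = c} {β₁ = β₁} {β₂ = β₂} {δ₁ = δ₁} {δ₂ = δ₂} g a₁ a₂ a₃ b₁ b₂ b₃ =
  cast h₂ h₃ k₂ k₃ (size-tableau (step (step (step g a₁) a₂) a₃))
  where
  -- The heights in the intermediate shapes equal heights in `γ` only propositionally; as variables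
  -- they can be matched with `refl`.
  cast : ∀ {q p′ p″ q′} → q ≡ height (suc c) γ → p′ ≡ suc (height c γ) → p″ ≡ suc (height c γ) → q′ ≡ height (suc c) γ →
    size (snocAt p′ (3 + n) (snocAt q (2 + n) (snocAt (height c γ) (1 + n) (tableau g)))) ≡ 3 + n →
    CSEdge (snocAt p′ (3 + n) (snocAt q (2 + n) (snocAt (height c γ) (1 + n) (tableau g))))
           (snocAt q′ (3 + n) (snocAt p″ (2 + n) (snocAt (height c γ) (1 + n) (tableau g))))
  cast refl refl refl refl = CSEdge-312 n (tableau g) (tableau-bounded g) (height-antitone γ (n≤1+n c)) (height≤length g a₁)
  c≢ : suc c ≢ c
  c≢ = 1+n≢n
  h₂ : height (suc c) β₁ ≡ height (suc c) γ
  h₂ = height-Addable-≢ a₁ c≢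
  h₃ : height c β₂ ≡ suc (height c γ)
  h₃ = trans (height-Addable-≢ a₂ (≢-sym c≢)) (height-Addable-≡ a₁)
  k₂ : height c δ₁ ≡ suc (height c γ)
  k₂ = height-Addable-≡ b₁
  k₃ : height (suc c) δ₂ ≡ height (suc c) γ
  k₃ = trans (height-Addable-≢ b₂ c≢) (height-Addable-≢ b₁ c≢)

Knuth-132 : (g : Path n γ) (a₁ : Addable r₁ c γ β₁) (a₂ : Addable r₂ (suc c) β₁ β₂) (a₃ : Addable r₃ (suc c) β₂ α)
  (b₁ : Addable s₁ (suc c) γ δ₁) (b₂ : Addable s₂ c δ₁ δ₂) (b₃ : Addable s₃ (suc c) δ₂ α) →
  CSEdge (tableau (step (step (step g a₁) a₂) a₃)) (tableau (step (step (step g b₁) b₂) b₃))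
Knuth-132 {n} {γ} {c = c} {β₁ = β₁} {β₂ = β₂} {δ₁ = δ₁} {δ₂ = δ₂} g a₁ a₂ a₃ b₁ b₂ b₃ =
  cast h₂ h₃ k₂ k₃ (size-tableau (step (step (step g a₁) a₂) a₃))
  where
  cast : ∀ {q q′ p q″} → q ≡ height (suc c) γ → q′ ≡ suc (height (suc c) γ) → p ≡ height c γ → q″ ≡ suc (height (suc c) γ) →
    size (snocAt q′ (3 + n) (snocAt q (2 + n) (snocAt (height c γ) (1 + n) (tableau g)))) ≡ 3 + n →
    CSEdge (snocAt q′ (3 + n) (snocAt q (2 + n) (snocAt (height c γ) (1 + n) (tableau g))))
           (snocAt q″ (3 + n) (snocAt p (2 + n) (snocAt (height (suc c) γ) (1 + n) (tableau g))))
  -- The strict inequality comes from the row of length `suc c` that `b₁` extends in `γ`.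
  cast refl refl refl refl =
    CSEdge-132 n (tableau g) (tableau-bounded g) (height-strict (Addable⇒At b₁) (n<1+n c)) (height≤length g a₁)
  c≢ : suc c ≢ c
  c≢ = 1+n≢n
  h₂ : height (suc c) β₁ ≡ height (suc c) γ
  h₂ = height-Addable-≢ a₁ c≢
  h₃ : height (suc c) β₂ ≡ suc (height (suc c) γ)
  h₃ = trans (height-Addable-≡ a₂) (cong suc h₂)
  k₂ : height c δ₁ ≡ height c γ
  k₂ = height-Addable-≢ b₁ (≢-sym c≢)
  k₃ : height (suc c) δ₂ ≡ suc (height (suc c) γ)
  k₃ = trans (height-Addable-≢ b₂ c≢) (height-Addable-≡ b₁)

-- Adjacency of growths

-- The first alternative joins growths that differ only in their proofs of addability.
Link : Path n α → Path n α → Set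
Link p q = tableau p ≡ tableau q ⊎ CSEdge (tableau p) (tableau q) ⊎ ∃[ i ] t i (label p) (label q)

infix 4 _≈_
_≈_ : Path n α → Path n α → Set
_≈_ = EqClosure Link

size-snocAt : ∀ r x S → size (snocAt r x S) ≡ suc (size S)
size-snocAt r       x []       = refl
size-snocAt zero    x (R ∷ Rs) = cong (_+ size Rs) (trans (length-++ R) (+-comm (length R) 1))
size-snocAt (suc r) x (R ∷ Rs) = trans (cong (length R +_) (size-snocAt r x Rs)) (+-suc (length R) (size Rs))

-- The interval ends at or before `size T`, so the larger letter `x` enters neither the restricted
-- words nor the cycle of letters.
CSEdge-snocAt : ∀ r → size T < x → CSEdge T U → CSEdge (snocAt r x T) (snocAt r x U)
CSEdge-snocAt {T} {x} r size<x (i , m , k , dyck , unpaired , refl) =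
  i , m , k ,
  record
    { m≥1         = m≥1
    ; lower       = lower
    ; upper       = ≤-trans upper (≤-trans (n≤1+n _) (≤-reflexive (sym (size-snocAt r x T))))
    ; shape-whole = trans (cong (shape ∘ insertionTableau) unchanged) shape-whole
    ; shape-half  = trans (cong (shape ∘ insertionTableau)
        (word-snocAt-hidden (λ y → (i ≤? y) ×-dec (y ≤? i + m)) r T λ (_ , x≤) →
          <⇒≱ whole<x (≤-trans x≤ (+-monoʳ-≤ i (m≤m+n m (m + 0)))))) shape-half
    } ,
  trans (cong (unpairedClosed 0 (i + m)) unchanged) unpaired ,
  sym (trans (map-snocAt _ r x T) (cong (λ y → snocAt r y _) (cycleLetter-> k+m<x)))
  where
  open IsDyckPatternInterval dyck
  whole<x : i + 2 * m < x
  whole<x = ≤-<-trans upper size<x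
  unchanged : row (snocAt r x T) ∣[ i , i + 2 * m ] ≡ row T ∣[ i , i + 2 * m ]
  unchanged = word-snocAt-hidden (λ y → (i ≤? y) ×-dec (y ≤? i + 2 * m)) r T λ (_ , x≤) → <⇒≱ whole<x x≤
  k≤i+m : k ≤ i + m
  k≤i+m = All.head (subst (All (_≤ i + m)) unpaired (unpairedClosed-≤ 0 (i + m) (row T ∣[ i , i + 2 * m ])))
  -- The letters moved are at most `k + m`, and `k ≤ i + m` keeps them within the interval.
  k+m<x : k + m < x
  k+m<x = ≤-<-trans (≤-trans (+-monoˡ-≤ m k≤i+m) (≤-reflexive (trans (+-assoc i m m) (cong (λ l → i + (m + l)) (sym (+-identityʳ m)))))) whole<x

t-snocAt : ∀ r → Bounded n T → t i T U → t i (snocAt r (suc n) T) (snocAt r (suc n) U)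
t-snocAt {n} {T} {i} s T≤n record { r = r ; r′ = r′ ; position-i = pos ; position-i+ = pos+
                                  ; columnsFar = far ; higher = r<r′ ; value = refl } = record
  { position-i  = entry-mono T s r pos
  ; position-i+ = entry-mono T s r′ pos+
  ; columnsFar  = far
  ; higher      = r<r′
  ; value       = sym (trans (map-snocAt _ s (suc n) T) (cong (λ y → snocAt s y _)
      (swapLetters-≢ (>⇒≢ (s≤s (entry-All T r T≤n pos))) (>⇒≢ (s≤s (entry-All T r′ T≤n pos+))))))
  }

Link-step : {p q : Path n β} (a : Addable r c β α) → Link p q → Link (step p a) (step q a)
Link-step a (inj₁ eq) = inj₁ (cong (snocAt _ _) eq)
Link-step {p = p} a (inj₂ (inj₁ e)) = inj₂ (inj₁ (CSEdge-snocAt _ (s≤s (≤-reflexive (size-tableau p))) e))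
Link-step {p = p} a (inj₂ (inj₂ (i , e))) = inj₂ (inj₂ (i , t-snocAt _ (label-bounded p) e))

≈-step : {p q : Path n β} (a : Addable r c β α) → p ≈ q → step p a ≈ step q a
≈-step a = EqClosure.gmap (λ p → step p a) (λ {p} {q} → Link-step {p = p} {q = q} a)

-- Appending a part, where a part 0 stands for no row at all.
_⊕_ : List ℕ → ℕ → List ℕ
zs ⊕ zero  = zs
zs ⊕ suc d = zs ++ [ suc d ]

top : ∀ zs d → Addable (length zs) d (zs ⊕ d) (zs ⊕ suc d)
top []       zero    = new
top []       (suc d) = here []
top (_ ∷ zs) zero    = there (top zs zero)
top (_ ∷ zs) (suc d) = there (top zs (suc d))

-- The last cell relative to the top row

-- Adds a cell in column `suc c` among the rows under the top one. The part of the side condition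
-- that concerns the top row is left to `raise`, so the same cell can be added under top rows of
-- various lengths. Column 0 does not occur, since new rows open only at the top.
data Below : (r c : ℕ) (zs zs′ : List ℕ) → Set where
  here  : All (suc c ≢_) zs → Below 0 c (suc c ∷ zs) (suc (suc c) ∷ zs)
  there : Below r c zs zs′ → Below (suc r) c (b ∷ zs) (b ∷ zs′)

Below-length : Below r c zs zs′ → length zs ≡ length zs′
Below-length (here _)  = refl
Below-length (there b) = cong suc (Below-length b)

Below-< : Below r c zs zs′ → r < length zs
Below-< (here _)  = s≤s z≤n
Below-< (there b) = s≤s (Below-< b)

Below-positive : Below r c zs zs′ → IsComposition zs′ → IsComposition zs
Below-positive (here _)  (_ ∷ ps) = s≤s z≤n ∷ ps
Below-positive (there b) (p ∷ ps) = p ∷ Below-positive b ps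

raise : ∀ d → Below r c zs zs′ → suc c ≢ d → Addable r (suc c) (zs ⊕ d) (zs′ ⊕ d)
raise zero    (here ps) c≢d = here ps
raise (suc d) (here ps) c≢d = here (All.++⁺ ps (c≢d ∷ []))
raise zero    (there b) c≢d = there (raise zero b c≢d)
raise (suc d) (there b) c≢d = there (raise (suc d) b c≢d)

-- In `below`, the inequality records that a top row of length `suc d` does not block the cell in
-- column `suc c`; this is the case excluded at the end of the overview.
data View (zs′ : List ℕ) (d : ℕ) : (r c : ℕ) (β : List ℕ) → Set where
  at-top : View zs′ d (length zs′) d (zs′ ⊕ d)
  below  : Below r c zs zs′ → suc c ≢ suc d → View zs′ d r (suc c) (zs ⊕ suc d)

View-∷ : View zs′ d r c β → View (b ∷ zs′) d (suc r) c (b ∷ β)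
View-∷ {d = zero}  at-top          = at-top
View-∷ {d = suc d} at-top          = at-top
View-∷             (below b c≢sd)  = below (there b) c≢sd

view : ∀ zs′ → Addable r c β α → α ≡ zs′ ⊕ suc d → View zs′ d r c β
view []           new       refl = at-top
view []           (here []) refl = at-top
view (_ ∷ [])     new       ()
view (_ ∷ _ ∷ _)  new       ()
view (_ ∷ zs′)    (here ps) refl = below (here (All.++⁻ˡ zs′ ps)) (All.head (All.++⁻ʳ zs′ ps))
view (_ ∷ zs′)    (there a) eq with refl ← ∷-injectiveˡ eq = View-∷ (view zs′ a (∷-injectiveʳ eq))

fill : ∀ {zs} d → Path n zs → Path (d + n) (zs ⊕ d)
fill zero    p = p
fill {zs = zs} (suc d) p = step (fill d p) (top zs d)

-- Filling the rows one at a time from the bottom always extends the top row, which no row can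
-- block.
superstandard : ∀ {xs} ys → Path n xs → IsComposition ys → ∃[ m ] Path m (xs ++ ys)
superstandard {xs = xs} [] p [] = _ , subst (Path _) (sym (++-identityʳ xs)) p
superstandard {xs = xs} (suc d ∷ ys) p (_ ∷ pos) with m , p′ ← superstandard ys (fill (suc d) p) pos =
  m , subst (Path m) (++-assoc xs [ suc d ] ys) p′

composition-path : IsComposition α → ∃[ m ] Path m α
composition-path {α} = superstandard α []

path-size : Path n α → Path m α → n ≡ m
path-size p q = trans (sym (sum-Path p)) (sum-Path q)

1<∣-∣ : ∀ c d → c ≢ d → d ≢ suc c → c ≢ suc d → 1 < ∣ c - d ∣
1<∣-∣ zero          zero          c≢d _ _ = contradiction refl c≢d
1<∣-∣ zero          (suc zero)    _ d≢ _  = contradiction refl d≢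
1<∣-∣ zero          (suc (suc d)) _ _ _   = s≤s (s≤s z≤n)
1<∣-∣ (suc zero)    zero          _ _ c≢  = contradiction refl c≢
1<∣-∣ (suc (suc c)) zero          _ _ _   = s≤s (s≤s z≤n)
1<∣-∣ (suc c)       (suc d)       c≢d d≢ c≢ = 1<∣-∣ c d (c≢d ∘ cong suc) (d≢ ∘ cong suc) (c≢ ∘ cong suc)

-- Both growths add the same two cells, in opposite orders. The source adds the lower cell first,
-- because `t` requires the larger letter to be higher.
far-edge : ∀ {r s s′ c d δ ε} (g : Path n γ) → s′ ≡ s → r < s → 1 < ∣ c - d ∣ →
  (a₁ : Addable r c γ δ) (a₂ : Addable s d δ α) (b₁ : Addable s′ d γ ε) (b₂ : Addable r c ε α) →
  t (suc n) (label (step (step g a₁) a₂)) (label (step (step g b₁) b₂))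
far-edge {n = n} {r = r} {s = s} {c = c} {d = d} g refl r<s far a₁ a₂ b₁ b₂ = record
  { r = r ; r′ = s ; c = c ; c′ = d
  ; position-i  = entry-mono (label (step g a₁)) s r (entry-new (label g) (At-label g a₁))
  ; position-i+ = entry-new (label (step g a₁)) (At-label (step g a₁) a₂)
  ; columnsFar  = far
  ; higher      = r<s
  ; value       = sym (begin
      map (map f) (snocAt s (2 + n) (snocAt r (1 + n) G))
        ≡⟨ map-snocAt f s _ _ ⟩
      snocAt s (f (2 + n)) (map (map f) (snocAt r (1 + n) G))
        ≡⟨ cong₂ (snocAt s) (swapLetters-ʳ (1 + n)) (map-snocAt f r _ _) ⟩
      snocAt s (1 + n) (snocAt r (f (1 + n)) (map (map f) G))
        ≡⟨ cong (snocAt s (1 + n)) (cong₂ (snocAt r) (swapLetters-ˡ (1 + n) (2 + n)) (map-map-fixed G fixed)) ⟩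
      snocAt s (1 + n) (snocAt r (2 + n) G)
        ≡⟨ snocAt-comm G r<len (<⇒≢ r<s) ⟩
      snocAt r (2 + n) (snocAt s (1 + n) G) ∎)
  }
  where
  open ≡-Reasoning
  G = label g
  f = swapLetters (1 + n) (2 + n)
  -- The higher cell can be added to `G` at once, so the row of the lower one already exists.
  r<len : r < length G
  r<len = <-≤-trans r<s (subst (s ≤_) (length-map length G) (At⇒≤length (At-label g b₁)))
  fixed : All (All (λ x → f x ≡ x)) G
  fixed = All.map (All.map λ x≤n → swapLetters-≢ (<⇒≢ (s≤s x≤n)) (<⇒≢ (m≤n⇒m≤1+n (s≤s x≤n)))) (label-bounded g)

-- Moving the last letter to the top row

Connects : ℕ → Set
Connects n = ∀ {α} (p q : Path n α) → p ≈ q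

link : {p q : Path n α} → Link p q → p ≈ q
link = return

same-cell : (p : Path n β) (a a′ : Addable r c β α) → step p a ≈ step p a′
same-cell p a a′ = link {p = step p a} {q = step p a′} (inj₁ refl)

-- The column called c in the overview is `suc c` here. In each case `conn` replaces `p` by a growth
-- that fills `zs` in some way, then the top row; any filling of `zs` serves, as the rewriting
-- concerns only the last two or three cells.
to-top : ∀ zs d → Connects n → (p : Path (suc n) (zs ⊕ suc d)) → ∃[ z ] p ≈ step {β = zs ⊕ d} z (top zs d)
to-top zs′ d conn (step p a) with view zs′ a refl
... | at-top = p , same-cell p a (top zs′ d)
... | below {c = c} {zs = zs} b c≢sd with suc c ≟ d | d ≟ 2 + c
to-top zs′ d conn (step p a) | below {c = c} {zs = zs} b c≢sd | yes refl | _
  with m , z ← composition-path (Below-positive b (All.++⁻ˡ zs′ (Path-positive (step p a))))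
  with g ← fill c z
  -- `composition-path` gives a growth of unspecified length; comparing sums identifies it with that
  -- of `p`.
  with refl ← path-size p (step (step g (top zs c)) (top zs (suc c))) =
  step (step g lower) (top zs′ c) ,
  ≈-step a (conn p (step (step g (top zs c)) (top zs (suc c)))) ◅◅
  same-cell (step (step g (top zs c)) (top zs (suc c))) a (raise (suc d) b c≢sd) ◅◅
  link {p = step (step (step g (top zs c)) (top zs (suc c))) (raise (suc d) b c≢sd)}
       {q = step (step (step g lower) (top zs′ c)) (top zs′ d)}
    (inj₂ (inj₁ (Knuth-132 g (top zs c) (top zs (suc c)) (raise (suc d) b c≢sd) lower (top zs′ c) (top zs′ d))))
  where
  -- The lower cell in column `suc c` is now added while the top row has length `c`, so it is not
  -- blocked.
  lower = raise c b 1+n≢n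
to-top zs′ d conn (step p a) | below {c = c} {zs = zs} b c≢sd | no c≢d | yes refl
  with m , z ← composition-path (Below-positive b (All.++⁻ˡ zs′ (Path-positive (step p a))))
  with g ← fill (suc c) z
  with refl ← path-size p (step (step g (top zs (suc c))) (top zs (2 + c))) =
  step (step g (top zs (suc c))) (raise (2 + c) b c≢d) ,
  ≈-step a (conn p (step (step g (top zs (suc c))) (top zs (2 + c)))) ◅◅
  same-cell (step (step g (top zs (suc c))) (top zs (2 + c))) a (raise (suc d) b c≢sd) ◅◅
  link {p = step (step (step g (top zs (suc c))) (top zs (2 + c))) (raise (suc d) b c≢sd)}
       {q = step (step (step g (top zs (suc c))) (raise (2 + c) b c≢d)) (top zs′ d)}
    (inj₂ (inj₁ (Knuth-312 g (top zs (suc c)) (top zs (2 + c)) (raise (suc d) b c≢sd) (top zs (suc c)) (raise (2 + c) b c≢d) (top zs′ d))))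
to-top zs′ d conn (step p a) | below {r = r} {c = c} {zs = zs} b c≢sd | no c≢d | no d≢sc
  with m , z ← composition-path (Below-positive b (All.++⁻ˡ zs′ (Path-positive (step p a))))
  with g ← fill d z
  with refl ← path-size p (step g (top zs d)) =
  step g (raise d b c≢d) ,
  ≈-step a (conn p (step g (top zs d))) ◅◅
  same-cell (step g (top zs d)) a (raise (suc d) b c≢sd) ◅◅
  -- The operator leads from the growth that ends in the top row to the given one, so its edge is
  -- traversed backwards.
  symmetric Link (link {p = step (step g (raise d b c≢d)) (top zs′ d)} {q = step (step g (top zs d)) (raise (suc d) b c≢sd)}
    (inj₂ (inj₂ (_ , far-edge g (Below-length b) (Below-<′ b) (1<∣-∣ (suc c) d c≢d d≢sc c≢sd) (raise d b c≢d) (top zs′ d)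
      (top zs d) (raise (suc d) b c≢sd)))))
  where
  Below-<′ : Below r c zs zs′ → r < length zs′
  Below-<′ b = subst (r <_) (Below-length b) (Below-< b)

connected : ∀ n → Connects n
connected zero    []         []           = ε
connected (suc n) {α} p q with initLast α | Path-positive p
connected (suc n) (step _ ()) q | [] | _
... | zs ∷ʳ′ zero  | pos = contradiction (All.head (All.++⁻ʳ zs pos)) λ ()
... | zs ∷ʳ′ suc d | _
  with z , p≈ ← to-top zs d (connected n) p
  with z′ , q≈ ← to-top zs d (connected n) q =
  p≈ ◅◅ ≈-step (top zs d) (connected n z z′) ◅◅ symmetric Link q≈

-- Every growth of `α` yields a vertex, so each `Link` is an edge or an equality. The closure is
-- folded into the equivalence on growths pulled back along `tableau`.
≈⇒QCS⁺ : {p q : Path n α} → p ≈ q → EqClosure (Adjacent (QCS⁺ α)) (tableau p) (tableau q)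
≈⇒QCS⁺ {α = α} = EqClosure.fold (On.isEquivalence tableau (EqClosure.isEquivalence _)) (λ {p} {q} → edge {p} {q})
  where
  edge : ∀ {p q} → Link p q → EqClosure (Adjacent (QCS⁺ α)) (tableau p) (tableau q)
  edge {p} {q} (inj₁ eq) = subst (EqClosure (Adjacent (QCS⁺ α)) (tableau p)) eq ε
  edge {p} {q} (inj₂ (inj₁ e)) = return (tableau-Vertex p , tableau-Vertex q , inj₁ e)
  edge {p} {q} (inj₂ (inj₂ (i , e))) =
    return (tableau-Vertex p , tableau-Vertex q , inj₂ (i , label p , label q , label-IsLabel p , label-IsLabel q , e))

vertex-path : IsComposition α → Vertex (QCS⁺ α) T → ∃[ p ] tableau {sum α} {α} p ≡ T
vertex-path pos (_ , _ , isSYCT , refl) with p , refl ← label-surjective pos isSYCT = p , sym (φ-label p)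

theorem4p21 : (α : List ℕ) → IsComposition α → Connected (QCS⁺ α)
theorem4p21 α comp = (tableau canonical , tableau-Vertex canonical) , connect
  where
  canonical = proj₂ (composition-path comp)
  connect : ∀ T U → Vertex (QCS⁺ α) T → Vertex (QCS⁺ α) U → EqClosure (Adjacent (QCS⁺ α)) T U
  connect T U vT vU with p , refl ← vertex-path comp vT with q , refl ← vertex-path comp vU =
    ≈⇒QCS⁺ (connected (sum α) p q)
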